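{- Let $G=(V,E)$ be a graph of treewidth $t$ and let $\mathcal{H}$ and $\mathcal{K}$ be two non-piercing families of subgraphs of $G$. Then there is an intersection support $\tilde{Q}$ for $(G,\mathcal{H},\mathcal{K})$ with $\mathrm{tw}(\tilde{Q})\le 2^{2^{t+4}+4(t+1)}$.
   Context: Subgraphs are identified with their vertex sets (induced subgraphs of $G$). A family of connected subgraphs of $G$ is non-piercing if for any two members $H,H'$ the subgraph of $G$ induced on $V(H)\setminus V(H')$ is connected. For $K\in\mathcal{K}$ let $\mathcal{H}_K=\{H\in\mathcal{H}: V(H)\cap V(K)\neq\emptyset\}$. An intersection support for $(G,\mathcal{H},\mathcal{K})$ is a graph $\tilde{Q}$ with vertex set $\mathcal{H}$ such that for each $K\in\mathcal{K}$, $\mathcal{H}_K$ induces a connected subgraph of $\tilde{Q}$. $\mathrm{tw}$ denotes treewidth. -}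

module Defs where

open import Data.Nat using (ℕ; zero; suc; _+_; _≤_)
open import Data.Fin using (Fin; zero; suc; inject₁; fromℕ)
open import Data.Fin.Subset using (Subset; _∈_; _∉_; ∣_∣)
open import Data.Product using (Σ; ∃; _×_; _,_)
open import Data.Unit using (⊤)
open import Relation.Nullary using (¬_)
open import Relation.Binary.PropositionalEquality using (_≡_)
open import Function.Definitions using (Injective)

record Graph (n : ℕ) : Set₁ where
  field
    Adj   : Fin n → Fin n → Set
    sym   : ∀ {u v} → Adj u v → Adj v u
    irrefl : ∀ {u} → ¬ Adj u u
open Graph public

data Walk {n : ℕ} (G : Graph n) (P : Fin n → Set) : Fin n → Fin n → Set where
  here : ∀ {u} → P u → Walk G P u u
  step : ∀ {u w v} → P u → Adj G u w → Walk G P w v → Walk G P u v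

-- The subgraph of G induced on the vertex set P is connected
-- (the empty vertex set counts as connected).
InducedConnected : {n : ℕ} → Graph n → (Fin n → Set) → Set
InducedConnected G P = ∀ u v → P u → P v → Walk G P u v

ConnectedSet : {n : ℕ} → Graph n → Subset n → Set
ConnectedSet G S = InducedConnected G (λ v → v ∈ S)

HasCycle : {m : ℕ} → Graph m → Set
HasCycle {m} T = Σ ℕ λ k → Σ (Fin (3 + k) → Fin m) λ c →
  Injective _≡_ _≡_ c ×
  (∀ (i : Fin (2 + k)) → Adj T (c (inject₁ i)) (c (suc i))) ×
  Adj T (c (fromℕ (2 + k))) (c zero)

record IsTree {m : ℕ} (T : Graph m) : Set where
  field
    nonempty  : Fin m
    connected : InducedConnected T (λ _ → ⊤)
    acyclic   : ¬ HasCycle T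

record TreeDecomposition {n : ℕ} (G : Graph n) (k : ℕ) : Set₁ where
  field
    m        : ℕ
    T        : Graph m
    isTree   : IsTree T
    bag      : Fin m → Subset n
    covers   : ∀ v → ∃ λ i → v ∈ bag i
    edges    : ∀ u v → Adj G u v → ∃ λ i → (u ∈ bag i × v ∈ bag i)
    subtree  : ∀ v → InducedConnected T (λ i → v ∈ bag i)
    width≤   : ∀ i → ∣ bag i ∣ ≤ suc k

TwLe : {n : ℕ} → Graph n → ℕ → Set₁
TwLe G k = TreeDecomposition G k

TwEq : {n : ℕ} → Graph n → ℕ → Set₁
TwEq G t = TwLe G t × (∀ k → TwLe G k → t ≤ k)

-- A family of connected subgraphs (identified with vertex sets), indexed by Fin h.
-- Members are nonempty and induce connected subgraphs.
record ConnectedFamily {n : ℕ} (G : Graph n) (h : ℕ) (F : Fin h → Subset n) : Set where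
  field
    nonempty  : ∀ i → ∃ λ v → v ∈ F i
    connected : ∀ i → ConnectedSet G (F i)

NonPiercing : {n : ℕ} → Graph n → {h : ℕ} → (Fin h → Subset n) → Set
NonPiercing G F = ∀ i j → InducedConnected G (λ v → (v ∈ F i) × (v ∉ F j))

Meets : {n : ℕ} → Subset n → Subset n → Set
Meets A B = ∃ λ v → (v ∈ A × v ∈ B)

IsIntersectionSupport : {n h k : ℕ} → (Fin h → Subset n) → (Fin k → Subset n) → Graph h → Set
IsIntersectionSupport Hs Ks Q = ∀ j → InducedConnected Q (λ i → Meets (Hs i) (Ks j))

{-# OPTIONS --safe #-}
-- A connected set with vertices on both sides of an edge of a decomposition tree meets the
-- adhesion set of that edge.  Only this consequence of connectivity is used, for the differences
-- of members of the two non-piercing families.  The decomposition tree is made cubic.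
--
-- Call a vertex covered if it lies in some H.  For a directed edge and a trace Z on its adhesion
-- set, pick among the K with trace Z that have a covered vertex beyond the edge one that is
-- smallest beyond the edge, and let a covered vertex of it be the representative.  If K misses
-- the representatives of its traces in both directions, then the two chosen minimal sets M and N
-- have M \ N on both sides of the edge but not on the adhesion set, so they pierce.  Adding the
-- representatives to the bags (at most 3 * 2^(t+1) per bag) thus makes the covered part of every
-- K meet the adhesion set of each edge on both sides of which it has vertices.
--
-- Say that P dominates H at a bag B if P has the larger index and contains H ∩ B.  Let M(B) be
-- the undominated members at B; there are at most 2^|B| of them.  When P dominates H at B, the
-- set H \ P lies in one component of the tree minus B, so P dominates H at every bag on the other
-- side.  Hence the bags at which H is undominated form a subtree, the M(B) restricted to the H
-- meeting a given K form a connected part of the tree, and every H that is nowhere undominated is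
-- contained in the union of M(B) and M(B') for some tree edge BB', where it is hung as a leaf.
module Submission where

open import Defs
open import Data.Bool using (true; false)
import Data.Bool.Properties as Bool
open import Data.Nat using (ℕ; zero; suc; _+_; _*_; _^_; _≤_; z≤n; s≤s)
import Data.Nat.Properties as ℕ
open import Data.Nat.Solver using (module +-*-Solver)
open import Data.Fin using (Fin; zero; suc; toℕ; inject₁; lower₁; fromℕ; punchOut) renaming (_<_ to _<ᶠ_; _≤_ to _≤ᶠ_)
import Data.Fin.Properties as Fin
open import Data.Fin.Subset using (Subset; _∈_; _∉_; _⊆_; _⊂_; _∩_; _∪_; ∁; ∣_∣; ⁅_⁆; ⊥)
open import Data.Fin.Subset.Properties
open import Data.List using (List; []; _∷_; map; _++_; length; lookup; allFin)
open import Data.List.Properties using (length-++; length-map)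
import Data.List.Membership.Propositional as List
open import Data.List.Membership.Propositional.Properties using (∈-map⁺; ∈-map⁻; ∈-++⁺ˡ; ∈-++⁺ʳ; ∈-++⁻; ∈-lookup; ∈-allFin)
open import Data.List.Relation.Unary.Any using (here; there)
open import Data.Vec using ([]; _∷_; tabulate)
open import Data.Vec.Properties using (lookup⇒[]=; []=⇒lookup; lookup∘tabulate; ≡-dec)
open import Data.Product as Product using (Σ; ∃; _×_; _,_; proj₁; proj₂)
open import Data.Sum as Sum using (_⊎_; inj₁; inj₂; [_,_]′)
import Data.Empty as Empty
open import Data.Empty using (⊥-elim)
open import Data.Unit using (⊤; tt)
open import Function using (_∘_)
open import Function.Definitions using (Injective)
open import Relation.Nullary using (¬_; Dec; yes; no; does)
open import Relation.Nullary.Decidable using (dec-true; _×-dec_; _→-dec_; ¬?; decidable-stable; toSum)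
open import Relation.Binary.PropositionalEquality using (_≡_; _≢_; refl; trans; cong; cong₂; subst) renaming (sym to ≡-sym)

-- Walks

module _ {n : ℕ} {G : Graph n} where

  infixr 5 _++ʷ_

  _++ʷ_ : ∀ {P u v w} → Walk G P u v → Walk G P v w → Walk G P u w
  here _     ++ʷ q = q
  step p e w ++ʷ q = step p e (w ++ʷ q)

  walk-start : ∀ {P u v} → Walk G P u v → P u
  walk-start (here p)     = p
  walk-start (step p _ _) = p

  reverseʷ : ∀ {P u v} → Walk G P u v → Walk G P v u
  reverseʷ (here p)     = here p
  reverseʷ (step p e w) = reverseʷ w ++ʷ step (walk-start w) (Graph.sym G e) (here p)

-- Finite subsets

∣p∪q∣≤∣p∣+∣q∣ : ∀ {n} (p q : Subset n) → ∣ p ∪ q ∣ ≤ ∣ p ∣ + ∣ q ∣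
∣p∪q∣≤∣p∣+∣q∣ [] [] = z≤n
∣p∪q∣≤∣p∣+∣q∣ (true ∷ p) (y ∷ q) =
  s≤s (ℕ.≤-trans (∣p∪q∣≤∣p∣+∣q∣ p q) (ℕ.+-monoʳ-≤ ∣ p ∣ (∣p∣≤∣x∷p∣ y q)))
∣p∪q∣≤∣p∣+∣q∣ (false ∷ p) (true ∷ q) =
  ℕ.≤-trans (s≤s (∣p∪q∣≤∣p∣+∣q∣ p q)) (ℕ.≤-reflexive (≡-sym (ℕ.+-suc ∣ p ∣ ∣ q ∣)))
∣p∪q∣≤∣p∣+∣q∣ (false ∷ p) (false ∷ q) = ∣p∪q∣≤∣p∣+∣q∣ p q

∣p∣≡∣p∩q∣+∣p∩∁q∣ : ∀ {n} (p q : Subset n) → ∣ p ∣ ≡ ∣ p ∩ q ∣ + ∣ p ∩ ∁ q ∣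
∣p∣≡∣p∩q∣+∣p∩∁q∣ [] [] = refl
∣p∣≡∣p∩q∣+∣p∩∁q∣ (false ∷ p) (y ∷ q) = ∣p∣≡∣p∩q∣+∣p∩∁q∣ p q
∣p∣≡∣p∩q∣+∣p∩∁q∣ (true ∷ p) (true ∷ q) = cong suc (∣p∣≡∣p∩q∣+∣p∩∁q∣ p q)
∣p∣≡∣p∩q∣+∣p∩∁q∣ (true ∷ p) (false ∷ q) =
  trans (cong suc (∣p∣≡∣p∩q∣+∣p∩∁q∣ p q)) (≡-sym (ℕ.+-suc ∣ p ∩ q ∣ ∣ p ∩ ∁ q ∣))

module _ {n : ℕ} {p q : Subset n} {x : Fin n} where

  ∪ˡ : x ∈ p → x ∈ p ∪ q
  ∪ˡ = x∈p∪q⁺ ∘ inj₁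

  ∪ʳ : x ∈ q → x ∈ p ∪ q
  ∪ʳ = x∈p∪q⁺ ∘ inj₂

  ∪⁻ : x ∈ p ∪ q → x ∈ p ⊎ x ∈ q
  ∪⁻ = x∈p∪q⁻ p q

  ∩⁺ : x ∈ p → x ∈ q → x ∈ p ∩ q
  ∩⁺ a b = x∈p∩q⁺ (a , b)

  ∩⁻ : x ∈ p ∩ q → x ∈ p × x ∈ q
  ∩⁻ = x∈p∩q⁻ p q

∣⊥∣≤ : ∀ n {a} → ∣ ⊥ {n} ∣ ≤ a
∣⊥∣≤ n = ℕ.≤-trans (ℕ.≤-reflexive (∣⊥∣≡0 n)) z≤n

setOf : ∀ {n} {P : Fin n → Set} → (∀ x → Dec (P x)) → Subset n
setOf P? = tabulate (does ∘ P?)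

module _ {n : ℕ} {P : Fin n → Set} (P? : ∀ x → Dec (P x)) where

  ∈-setOf⁺ : ∀ {x} → P x → x ∈ setOf P?
  ∈-setOf⁺ {x} px = lookup⇒[]= x _ (trans (lookup∘tabulate _ x) (dec-true (P? x) px))

  ∈-setOf⁻ : ∀ {x} → x ∈ setOf P? → P x
  ∈-setOf⁻ {x} x∈ with P? x | trans (≡-sym (lookup∘tabulate (does ∘ P?) x)) ([]=⇒lookup x∈)
  ... | yes px | _  = px
  ... | no _   | ()

-- Traces on a bag, and one chosen witness for each

subsets : ∀ {n} → Subset n → List (Subset n)
subsets []          = [] ∷ []
subsets (false ∷ p) = map (false ∷_) (subsets p)
subsets (true ∷ p)  = map (false ∷_) (subsets p) ++ map (true ∷_) (subsets p)

length-subsets : ∀ {n} (p : Subset n) → length (subsets p) ≡ 2 ^ ∣ p ∣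
length-subsets [] = refl
length-subsets (false ∷ p) = trans (length-map (false ∷_) (subsets p)) (length-subsets p)
length-subsets (true ∷ p) = trans (length-++ (map (false ∷_) (subsets p)))
  (cong₂ _+_ (trans (length-map (false ∷_) (subsets p)) (length-subsets p))
             (trans (trans (length-map (true ∷_) (subsets p)) (length-subsets p))
                    (≡-sym (ℕ.+-identityʳ _))))

∩∈subsets : ∀ {n} (q p : Subset n) → (q ∩ p) List.∈ subsets p
∩∈subsets [] [] = here refl
∩∈subsets (true ∷ q) (true ∷ p) =
  ∈-++⁺ʳ (map (false ∷_) (subsets p)) (∈-map⁺ (true ∷_) (∩∈subsets q p))
∩∈subsets (false ∷ q) (true ∷ p) = ∈-++⁺ˡ (∈-map⁺ (false ∷_) (∩∈subsets q p))
∩∈subsets (true ∷ q) (false ∷ p) = ∈-map⁺ (false ∷_) (∩∈subsets q p)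
∩∈subsets (false ∷ q) (false ∷ p) = ∈-map⁺ (false ∷_) (∩∈subsets q p)

subsets-⊆ : ∀ {n} (p : Subset n) {q} → q List.∈ subsets p → q ⊆ p
subsets-⊆ [] (here refl) x∈ = x∈
subsets-⊆ (false ∷ p) q∈ x∈ with ∈-map⁻ (false ∷_) q∈
... | _ , q′∈ , refl = out⊆ (subsets-⊆ p q′∈) x∈
subsets-⊆ (true ∷ p) q∈ x∈ with ∈-++⁻ (map (false ∷_) (subsets p)) q∈
... | inj₁ q∈′ with ∈-map⁻ (false ∷_) q∈′
...   | _ , q′∈ , refl = out⊆ (subsets-⊆ p q′∈) x∈
subsets-⊆ (true ∷ p) q∈ x∈ | inj₂ q∈′ with ∈-map⁻ (true ∷_) q∈′
...   | _ , q′∈ , refl = in⊆in (subsets-⊆ p q′∈) x∈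

module _ {A : Set} {m : ℕ} {Q : A → Fin m → Set} (Q? : ∀ Z → Dec (∃ (Q Z))) where

  choose : List A → Subset m
  choose [] = ⊥
  choose (Z ∷ Zs) with Q? Z
  ... | yes (x , _) = ⁅ x ⁆ ∪ choose Zs
  ... | no _        = choose Zs

  choose-sound : ∀ Zs {x} → x ∈ choose Zs → ∃ λ Z → Z List.∈ Zs × Q Z x
  choose-sound [] x∈ = ⊥-elim (∉⊥ x∈)
  choose-sound (Z ∷ Zs) x∈ with Q? Z
  ... | no _ = let Z′ , Z′∈ , q = choose-sound Zs x∈ in Z′ , there Z′∈ , q
  ... | yes (y , qy) with ∪⁻ x∈
  ...   | inj₁ x∈y = Z , here refl , subst (Q Z) (≡-sym (x∈⁅y⁆⇒x≡y y x∈y)) qy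
  ...   | inj₂ x∈′ = let Z′ , Z′∈ , q = choose-sound Zs x∈′ in Z′ , there Z′∈ , q

  choose-complete : ∀ {Zs Z} → Z List.∈ Zs → ∃ (Q Z) → ∃ λ x → x ∈ choose Zs × Q Z x
  choose-complete {Z ∷ Zs} (here refl) e with Q? Z
  ... | yes (x , q) = x , ∪ˡ (x∈⁅x⁆ x) , q
  ... | no ¬e       = ⊥-elim (¬e e)
  choose-complete {Z′ ∷ Zs} (there Z∈) e with choose-complete Z∈ e | Q? Z′
  ... | x , x∈ , q | yes _ = x , ∪ʳ x∈ , q
  ... | x , x∈ , q | no _  = x , x∈ , q

  ∣choose∣≤length : ∀ Zs → ∣ choose Zs ∣ ≤ length Zs
  ∣choose∣≤length [] = ℕ.≤-reflexive (∣⊥∣≡0 m)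
  ∣choose∣≤length (Z ∷ Zs) with Q? Z
  ... | no _ = ℕ.m≤n⇒m≤1+n (∣choose∣≤length Zs)
  ... | yes (x , _) = ℕ.≤-trans (∣p∪q∣≤∣p∣+∣q∣ ⁅ x ⁆ (choose Zs))
    (ℕ.+-mono-≤ (ℕ.≤-reflexive (∣⁅x⁆∣≡1 x)) (∣choose∣≤length Zs))

∣choose-subsets∣≤2^ : ∀ {n m} {Q : Subset n → Fin m → Set} (Q? : ∀ Z → Dec (∃ (Q Z))) (p : Subset n) →
  ∣ choose Q? (subsets p) ∣ ≤ 2 ^ ∣ p ∣
∣choose-subsets∣≤2^ Q? p = ℕ.≤-trans (∣choose∣≤length Q? (subsets p)) (ℕ.≤-reflexive (length-subsets p))

greatest : ∀ {h} {P : Fin h → Set} → (∀ i → Dec (P i)) → ∃ P → ∃ λ i → P i × (∀ j → i <ᶠ j → ¬ P j)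
greatest {suc h} {P} P? (i , pi) with Fin.any? (P? ∘ suc)
... | yes e = let j , pj , gt = greatest (P? ∘ suc) e in
  suc j , pj , λ where zero ()
                       (suc j′) (s≤s j<) → gt j′ j<
... | no ¬e with i
...   | zero  = zero , pi , λ where zero ()
                                    (suc j) _ pj → ¬e (j , pj)
...   | suc j = ⊥-elim (¬e (j , pi))

least : ∀ {k} {P : Fin k → Set} → (∀ i → Dec (P i)) → (f : Fin k → ℕ) → ∃ P →
  ∃ λ i → P i × (∀ j → P j → f i ≤ f j)
least {suc k} {P} P? f (i , pi) with Fin.any? (P? ∘ suc) | P? zero
... | no ¬e | no ¬p₀ = ⊥-elim ([ ¬p₀ , ¬e ]′ (split i pi))
  where
  split : ∀ i → P i → P zero ⊎ ∃ (P ∘ suc)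
  split zero    p = inj₁ p
  split (suc i) p = inj₂ (i , p)
... | no ¬e | yes p₀ = zero , p₀ , λ where zero _ → ℕ.≤-refl
                                           (suc j) pj → ⊥-elim (¬e (j , pj))
... | yes e | p₀? with least (P? ∘ suc) (f ∘ suc) e | p₀?
...   | j , pj , le | no ¬p₀ = suc j , pj , λ where zero p → ⊥-elim (¬p₀ p)
                                                    (suc j′) p → le j′ p
...   | j , pj , le | yes p₀ with ℕ.≤-total (f zero) (f (suc j))
...     | inj₁ z≤ = zero , p₀ , λ where zero _ → ℕ.≤-refl
                                        (suc j′) p → ℕ.≤-trans z≤ (le j′ p)
...     | inj₂ ≤z = suc j , pj , λ where zero _ → ≤z
                                         (suc j′) p → le j′ p

-- Binary trees of bags

data Tree (n : ℕ) : Set where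
  nil  : Tree n
  node : Subset n → Tree n → Tree n → Tree n

module _ {n : ℕ} where

  root : Tree n → Subset n
  root nil          = ⊥
  root (node B _ _) = B

  infix 4 _∈ᵇ_ _∈ᵛ_ _∈ᵛ?_

  data _∈ᵇ_ (B : Subset n) : Tree n → Set where
    top   : ∀ {l r} → B ∈ᵇ node B l r
    left  : ∀ {B′ l r} → B ∈ᵇ l → B ∈ᵇ node B′ l r
    right : ∀ {B′ l r} → B ∈ᵇ r → B ∈ᵇ node B′ l r

  data _∈ᵛ_ (x : Fin n) : Tree n → Set where
    top   : ∀ {B l r} → x ∈ B → x ∈ᵛ node B l r
    left  : ∀ {B l r} → x ∈ᵛ l → x ∈ᵛ node B l r
    right : ∀ {B l r} → x ∈ᵛ r → x ∈ᵛ node B l r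

  _∈ᵛ?_ : ∀ x τ → Dec (x ∈ᵛ τ)
  x ∈ᵛ? nil = no λ ()
  x ∈ᵛ? node B l r with x ∈? B | x ∈ᵛ? l | x ∈ᵛ? r
  ... | yes x∈ | _      | _      = yes (top x∈)
  ... | no _   | yes x∈ | _      = yes (left x∈)
  ... | no _   | no _   | yes x∈ = yes (right x∈)
  ... | no ∉B  | no ∉l  | no ∉r  = no λ where
    (top x∈)   → ∉B x∈
    (left x∈)  → ∉l x∈
    (right x∈) → ∉r x∈

  verts : Tree n → Subset n
  verts τ = setOf (_∈ᵛ? τ)

  root⊆ : ∀ τ {x} → x ∈ root τ → x ∈ᵛ τ
  root⊆ nil          x∈ = ⊥-elim (∉⊥ x∈)
  root⊆ (node B l r) x∈ = top x∈

  bag⊆ : ∀ {B τ x} → B ∈ᵇ τ → x ∈ B → x ∈ᵛ τ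
  bag⊆ top        x∈ = top x∈
  bag⊆ (left B∈)  x∈ = left (bag⊆ B∈ x∈)
  bag⊆ (right B∈) x∈ = right (bag⊆ B∈ x∈)

  ∈ᵛ⇒∈bag : ∀ {τ x} → x ∈ᵛ τ → ∃ λ B → B ∈ᵇ τ × x ∈ B
  ∈ᵛ⇒∈bag (top x∈)   = _ , top , x∈
  ∈ᵛ⇒∈bag (left x∈)  = let B , B∈ , x∈B = ∈ᵛ⇒∈bag x∈ in B , left B∈ , x∈B
  ∈ᵛ⇒∈bag (right x∈) = let B , B∈ , x∈B = ∈ᵛ⇒∈bag x∈ in B , right B∈ , x∈B

  -- The running intersection property of a tree decomposition.
  data Valid : Tree n → Set where
    nil  : Valid nil
    node : ∀ {B l r} → Valid l → Valid r →
      (∀ {x} → x ∈ᵛ l → x ∈ᵛ r → x ∈ B) →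
      (∀ {x} → x ∈ B → x ∈ᵛ l → x ∈ root l) →
      (∀ {x} → x ∈ B → x ∈ᵛ r → x ∈ root r) →
      Valid (node B l r)

  -- A node has no third child to spare, so its bag is duplicated: the upper copy gets the new leaf
  -- on its left and the old node on its right.
  insert : ∀ {B τ} → B ∈ᵇ τ → Subset n → Tree n
  insert {τ = node B l r} top B⁺        = node B (node B⁺ nil nil) (node B l r)
  insert {τ = node B l r} (left B∈) B⁺  = node B (insert B∈ B⁺) r
  insert {τ = node B l r} (right B∈) B⁺ = node B l (insert B∈ B⁺)

  module _ {B⁺ : Subset n} where

    root-insert : ∀ {B τ} (B∈ : B ∈ᵇ τ) → root (insert B∈ B⁺) ≡ root τ
    root-insert top       = refl
    root-insert (left _)  = refl
    root-insert (right _) = refl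

    insert-new : ∀ {B τ} (B∈ : B ∈ᵇ τ) → B⁺ ∈ᵇ insert B∈ B⁺
    insert-new top        = left top
    insert-new (left B∈)  = left (insert-new B∈)
    insert-new (right B∈) = right (insert-new B∈)

    insert-old : ∀ {B τ B′} (B∈ : B ∈ᵇ τ) → B′ ∈ᵇ τ → B′ ∈ᵇ insert B∈ B⁺
    insert-old top        B′∈         = right B′∈
    insert-old (left _)   top         = top
    insert-old (left B∈)  (left B′∈)  = left (insert-old B∈ B′∈)
    insert-old (left _)   (right B′∈) = right B′∈
    insert-old (right _)  top         = top
    insert-old (right _)  (left B′∈)  = left B′∈
    insert-old (right B∈) (right B′∈) = right (insert-old B∈ B′∈)

    insert-bag⁻ : ∀ {B τ B′} (B∈ : B ∈ᵇ τ) → B′ ∈ᵇ insert B∈ B⁺ → B′ ≡ B⁺ ⊎ B′ ∈ᵇ τ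
    insert-bag⁻ top        top         = inj₂ top
    insert-bag⁻ top        (left top)  = inj₁ refl
    insert-bag⁻ top        (right B′∈) = inj₂ B′∈
    insert-bag⁻ (left _)   top         = inj₂ top
    insert-bag⁻ (left B∈)  (left B′∈)  = Sum.map₂ left (insert-bag⁻ B∈ B′∈)
    insert-bag⁻ (left _)   (right B′∈) = inj₂ (right B′∈)
    insert-bag⁻ (right _)  top         = inj₂ top
    insert-bag⁻ (right _)  (left B′∈)  = inj₂ (left B′∈)
    insert-bag⁻ (right B∈) (right B′∈) = Sum.map₂ right (insert-bag⁻ B∈ B′∈)

    ∈ᵛ-insert⁻ : ∀ {B τ x} (B∈ : B ∈ᵇ τ) → x ∈ᵛ insert B∈ B⁺ → x ∈ B⁺ ⊎ x ∈ᵛ τ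
    ∈ᵛ-insert⁻ B∈ x∈ with ∈ᵛ⇒∈bag x∈
    ... | B′ , B′∈ , x∈B′ with insert-bag⁻ B∈ B′∈
    ...   | inj₁ refl = inj₁ x∈B′
    ...   | inj₂ B′∈τ = inj₂ (bag⊆ B′∈τ x∈B′)

    insert-valid : ∀ {B τ} (B∈ : B ∈ᵇ τ) → Valid τ →
      (∀ {x} → x ∈ B⁺ → x ∈ᵛ τ → x ∈ B) → Valid (insert B∈ B⁺)
    insert-valid top v new = node (node nil nil (λ ()) (λ _ ()) (λ _ ())) v
      (λ where (top x∈) x∈τ → new x∈ x∈τ
               (left ())
               (right ()))
      (λ where _ (top x∈) → x∈
               _ (left ())
               _ (right ()))
      (λ x∈ _ → x∈)
    insert-valid {τ = node A l r} (left B∈) (node vl vr lr Al Ar) new =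
      node (insert-valid B∈ vl (λ x∈ x∈l → new x∈ (left x∈l))) vr
        (λ x∈ x∈r → [ (λ x∈⁺ → lr (bag⊆ B∈ (new x∈⁺ (right x∈r))) x∈r) , (λ x∈l → lr x∈l x∈r) ]′
                      (∈ᵛ-insert⁻ B∈ x∈))
        (λ x∈A x∈ → subst (_ ∈_) (≡-sym (root-insert B∈))
          ([ (λ x∈⁺ → Al x∈A (bag⊆ B∈ (new x∈⁺ (top x∈A)))) , Al x∈A ]′ (∈ᵛ-insert⁻ B∈ x∈)))
        Ar
    insert-valid {τ = node A l r} (right B∈) (node vl vr lr Al Ar) new =
      node vl (insert-valid B∈ vr (λ x∈ x∈r → new x∈ (right x∈r)))
        (λ x∈l x∈ → [ (λ x∈⁺ → lr x∈l (bag⊆ B∈ (new x∈⁺ (left x∈l)))) , lr x∈l ]′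
                      (∈ᵛ-insert⁻ B∈ x∈))
        Al
        (λ x∈A x∈ → subst (_ ∈_) (≡-sym (root-insert B∈))
          ([ (λ x∈⁺ → Ar x∈A (bag⊆ B∈ (new x∈⁺ (top x∈A)))) , Ar x∈A ]′ (∈ᵛ-insert⁻ B∈ x∈)))

-- Splits of a tree along an edge

Sep : ∀ {n} → (Fin n → Set) → Tree n → Tree n → Set
Sep X σ τ = ∀ {u v} → X u → X v → u ∈ᵛ σ → v ∈ᵛ τ → ∃ λ w → X w × w ∈ᵛ σ × w ∈ᵛ τ

-- A pair (σ , τ) of rooted binary trees is an unrooted cubic tree with a marked edge; the edge
-- moves across a node keeping the cyclic order of its three neighbours, so that moving there
-- and back gives the same pair.
record Rerootable {n : ℕ} (I : Tree n → Tree n → Set) : Set where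
  field
    flip : ∀ {σ τ} → I σ τ → I τ σ
    toˡ  : ∀ {σ B l r} → I σ (node B l r) → I (node B r σ) l
    meet : ∀ {σ τ x} → I σ τ → x ∈ᵛ σ → x ∈ᵛ τ → x ∈ root σ

  toʳ : ∀ {σ B l r} → I σ (node B l r) → I (node B σ l) r
  -- Seen from `l`, the other neighbours of the node are `r` and `σ` in this order, so a second move
  -- to the left reaches `r`.
  toʳ i = toˡ (flip (toˡ i))

record Split {n : ℕ} (G : Graph n) (σ τ : Tree n) : Set where
  field
    validˡ  : Valid σ
    validʳ  : Valid τ
    common : ∀ {x} → x ∈ᵛ σ → x ∈ᵛ τ → x ∈ root σ × x ∈ root τ
    spans   : ∀ x → x ∈ᵛ σ ⊎ x ∈ᵛ τ
    edges   : ∀ {u v} → Adj G u v → ∃ λ B → (B ∈ᵇ σ ⊎ B ∈ᵇ τ) × u ∈ B × v ∈ B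

module _ {n : ℕ} {G : Graph n} where

  split-reroot : Rerootable (Split G)
  split-reroot = record
    { flip = λ s → let open Split s in record
        { validˡ  = validʳ
        ; validʳ  = validˡ
        ; common = λ x∈ y∈ → Product.swap (common y∈ x∈)
        ; spans   = Sum.swap ∘ spans
        ; edges   = λ e → let B , B∈ , uv = edges e in B , Sum.swap B∈ , uv
        }
    ; toˡ  = toˡ
    ; meet = λ s x∈ y∈ → proj₁ (Split.common s x∈ y∈)
    }
    where
    toˡ : ∀ {σ B l r} → Split G σ (node B l r) → Split G (node B r σ) l
    toˡ {σ} {B} {l} {r}
      record { validˡ = vσ ; validʳ = node vl vr lr Bl Br ; common = ov ; spans = sp ; edges = ed } = record
      { validˡ  = node vr vσ (λ x∈r x∈σ → proj₂ (ov x∈σ (right x∈r))) Br (λ x∈B x∈σ → proj₁ (ov x∈σ (top x∈B)))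
      ; validʳ  = vl
      ; common = λ x∈ x∈l → let x∈B = inB x∈ x∈l in x∈B , Bl x∈B x∈l
      ; spans   = λ x → sp′ (sp x)
      ; edges   = λ e → let b , b∈ , uv = ed e in b , ed′ b∈ , uv
      }
      where
      inB : ∀ {x} → x ∈ᵛ node B r σ → x ∈ᵛ l → x ∈ B
      inB (top x∈B)   _   = x∈B
      inB (left x∈r)  x∈l = lr x∈l x∈r
      inB (right x∈σ) x∈l = proj₂ (ov x∈σ (left x∈l))

      sp′ : ∀ {x} → x ∈ᵛ σ ⊎ x ∈ᵛ node B l r → x ∈ᵛ node B r σ ⊎ x ∈ᵛ l
      sp′ (inj₁ x∈σ)         = inj₁ (right x∈σ)
      sp′ (inj₂ (top x∈B))   = inj₁ (top x∈B)
      sp′ (inj₂ (left x∈l))  = inj₂ x∈l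
      sp′ (inj₂ (right x∈r)) = inj₁ (left x∈r)

      ed′ : ∀ {b} → b ∈ᵇ σ ⊎ b ∈ᵇ node B l r → b ∈ᵇ node B r σ ⊎ b ∈ᵇ l
      ed′ (inj₁ b∈σ)         = inj₁ (right b∈σ)
      ed′ (inj₂ top)         = inj₁ top
      ed′ (inj₂ (left b∈l))  = inj₂ b∈l
      ed′ (inj₂ (right b∈r)) = inj₁ (left b∈r)

  -- The bag holding the next edge of the walk lies on one side. In `σ`, the next vertex is still in
  -- `σ`; in `τ`, the current vertex is on both sides.
  connected⇒sep : ∀ {σ τ X} → Split G σ τ → InducedConnected G X → Sep X σ τ
  connected⇒sep {σ} {τ} {X} s con {u} {v} xu xv u∈ v∈ = go (con u v xu xv) u∈ v∈
    where
    go : ∀ {u v} → Walk G X u v → u ∈ᵛ σ → v ∈ᵛ τ → ∃ λ w → X w × w ∈ᵛ σ × w ∈ᵛ τ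
    go (here xu) u∈ v∈ = _ , xu , u∈ , v∈
    go (step xu e w) u∈ v∈ with Split.edges s e
    ... | _ , inj₁ B∈ , _ , y∈ = go w (bag⊆ B∈ y∈) v∈
    ... | _ , inj₂ B∈ , u∈B , _ = _ , xu , u∈ , bag⊆ B∈ u∈B

-- Undominated members

module Dual {n h : ℕ} (H : Fin h → Subset n) where

  Top : Subset n → Fin h → Set
  Top Z P = Z ⊆ H P × (∀ P′ → P <ᶠ P′ → ¬ Z ⊆ H P′)

  top? : ∀ Z → Dec (∃ (Top Z))
  top? Z = Fin.any? λ P → (Z ⊆? H P) ×-dec Fin.all? λ P′ → (P Fin.<? P′) →-dec ¬? (Z ⊆? H P′)

  -- This is M(B). An undominated member is `Top` for its own trace. Conversely, a member dominating
  -- `P` at `B` contains every `Z ⊆ B` that `P` contains, so letting `Z` range over all subsets adds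
  -- nothing.
  tops : Subset n → Subset h
  tops B = choose top? (subsets B)

  ∣tops∣≤ : ∀ B → ∣ tops B ∣ ≤ 2 ^ ∣ B ∣
  ∣tops∣≤ = ∣choose-subsets∣≤2^ top?

  dominate : ∀ B P → ∃ λ P′ → P′ ∈ tops B × P ≤ᶠ P′ × (∀ {v} → v ∈ B → v ∈ H P → v ∈ H P′)
  dominate B P with choose-complete top? (∩∈subsets (H P) B)
                      (greatest (λ P′ → (H P ∩ B) ⊆? H P′) (P , p∩q⊆p (H P) B))
  ... | P′ , P′∈ , Z⊆ , gt =
    P′ , P′∈ , ℕ.≮⇒≥ (λ P′<P → gt P P′<P (p∩q⊆p (H P) B)) , λ v∈B v∈P → Z⊆ (∩⁺ v∈P v∈B)

  undominated : ∀ {B P P′} → P ∈ tops B → P ≤ᶠ P′ → (∀ {v} → v ∈ B → v ∈ H P → v ∈ H P′) → P′ ≡ P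
  undominated {B} {P} {P′} P∈ P≤ B⊆ with P Fin.≟ P′
  ... | yes refl = refl
  ... | no P≢P′ = let Z , Z∈ , Z⊆ , gt = choose-sound top? (subsets B) P∈ in
    ⊥-elim (gt P′ (Fin.≤∧≢⇒< P≤ P≢P′) (λ v∈Z → B⊆ (subsets-⊆ B Z∈ v∈Z) (Z⊆ v∈Z)))

  -- `m` is the undominated set of the parent, so the bags stand for edges of the old tree, and
  -- members undominated at adjacent nodes share a bag.
  link : Subset h → Tree n → Tree h
  link m nil          = nil
  link m (node B l r) = node (m ∪ tops B) (link (tops B) l) (link (tops B) r)

  core : Tree n → Tree h
  core nil          = nil
  core (node B l r) = node (tops B) (core l) (core r)

  core-bag : ∀ {τ P} → P ∈ᵛ core τ → ∃ λ B → B ∈ᵇ τ × P ∈ tops B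
  core-bag {node B l r} (top P∈)   = B , top , P∈
  core-bag {node B l r} (left P∈)  = let B′ , B′∈ , P∈′ = core-bag P∈ in B′ , left B′∈ , P∈′
  core-bag {node B l r} (right P∈) = let B′ , B′∈ , P∈′ = core-bag P∈ in B′ , right B′∈ , P∈′

  link⊆ : ∀ {m τ P} → P ∈ᵛ link m τ → P ∈ m ⊎ P ∈ᵛ core τ
  link⊆ {m} {node B l r} (top P∈)   = Sum.map₂ top (∪⁻ {p = m} P∈)
  link⊆ {m} {node B l r} (left P∈)  = inj₂ ([ top , left ]′ (link⊆ P∈))
  link⊆ {m} {node B l r} (right P∈) = inj₂ ([ top , right ]′ (link⊆ P∈))

  ∣link∣≤ : ∀ {s m τ} → ∣ m ∣ ≤ 2 ^ s → (∀ {B} → B ∈ᵇ τ → ∣ B ∣ ≤ s) →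
    ∀ {X} → X ∈ᵇ link m τ → ∣ X ∣ ≤ 2 ^ s + 2 ^ s
  ∣link∣≤ {s} {m} {node B l r} m≤ B≤ top = ℕ.≤-trans (∣p∪q∣≤∣p∣+∣q∣ m (tops B))
    (ℕ.+-mono-≤ m≤ (ℕ.≤-trans (∣tops∣≤ B) (ℕ.^-monoʳ-≤ 2 (B≤ top))))
  ∣link∣≤ {s} {m} {node B l r} m≤ B≤ (left X∈) =
    ∣link∣≤ (ℕ.≤-trans (∣tops∣≤ B) (ℕ.^-monoʳ-≤ 2 (B≤ top))) (B≤ ∘ left) X∈
  ∣link∣≤ {s} {m} {node B l r} m≤ B≤ (right X∈) =
    ∣link∣≤ (ℕ.≤-trans (∣tops∣≤ B) (ℕ.^-monoʳ-≤ 2 (B≤ top))) (B≤ ∘ right) X∈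

  module _ {I : Tree n → Tree n → Set} (reroot : Rerootable I)
           (sep : ∀ {σ τ} → I σ τ → ∀ P P′ → Sep (λ v → v ∈ H P × v ∉ H P′) σ τ)
           (total : ∀ {σ τ} → I σ τ → ∀ {P v} → v ∈ H P → v ∈ᵛ σ ⊎ v ∈ᵛ τ) where

    open Rerootable reroot

    -- Vertices of `H P` outside `H P′` on both sides would by `sep` give a common one; `meet` puts
    -- it in `B`, where `H P` is inside `H P′`.
    one-sided : ∀ {B x y τ P P′ u v} → I (node B x y) τ → (∀ {w} → w ∈ B → w ∈ H P → w ∈ H P′) →
      u ∈ H P → u ∈ᵛ node B x y → u ∉ H P′ → v ∈ H P → v ∈ᵛ τ → v ∈ H P′
    one-sided {P = P} {P′} {v = v} i B⊆ u∈ u∈σ u∉ v∈ v∈τ with v ∈? H P′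
    ... | yes v∈′ = v∈′
    ... | no v∉ = let w , (w∈ , w∉) , w∈σ , w∈τ = sep i P P′ (u∈ , u∉) (v∈ , v∉) u∈σ v∈τ in
      ⊥-elim (w∉ (B⊆ (meet i w∈σ w∈τ) w∈))

    -- Let `P′` dominate `P` at the root of `σ`. If `P′` misses `v`, then by `one-sided` it contains
    -- all of `H P` in `τ`, in particular at the bag where `P` is undominated, so `P′` is `P`.
    transfer : ∀ {σ τ P v} → I σ τ → P ∈ᵛ core τ → v ∈ H P → v ∈ᵛ σ →
      ∃ λ P′ → P′ ∈ root (core σ) × v ∈ H P′
    transfer {node B x y} {τ} {P} {v} i P∈ v∈ v∈σ with dominate B P
    ... | P′ , P′∈ , P≤ , B⊆ with v ∈? H P′
    ...   | yes v∈′ = P′ , P′∈ , v∈′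
    ...   | no v∉ =
      let b , b∈ , P∈b = core-bag P∈
          P′≡P = undominated P∈b P≤ (λ w∈b w∈ → one-sided i B⊆ v∈ v∈σ v∉ w∈ (bag⊆ b∈ w∈b))
      in P′ , P′∈ , subst (λ Q → v ∈ H Q) (≡-sym P′≡P) v∈

    -- The dominator `P′` of `P` at the root of `σ` contains `H P` on the bag `b`, or it misses a
    -- vertex there and by `one-sided` contains `H P` on `b′`. Either way `undominated` gives
    -- `P′ ≡ P`.
    core-meet : ∀ {σ τ P} → I σ τ → P ∈ᵛ core σ → P ∈ᵛ core τ → P ∈ root (core σ)
    core-meet {node B x y} {τ} {P} i P∈σ P∈τ with dominate B P | core-bag P∈σ
    ... | P′ , P′∈ , P≤ , B⊆ | b , b∈ , P∈b with Fin.any? (λ v → (v ∈? b) ×-dec (v ∈? H P) ×-dec ¬? (v ∈? H P′))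
    ...   | no none = subst (_∈ tops B) (undominated P∈b P≤ λ {v} v∈b v∈ →
              decidable-stable (v ∈? H P′) λ v∉ → none (v , v∈b , v∈ , v∉)) P′∈
    ...   | yes (v , v∈b , v∈ , v∉) =
      let b′ , b′∈ , P∈b′ = core-bag P∈τ in
      subst (_∈ tops B) (undominated P∈b′ P≤ λ w∈b w∈ → one-sided i B⊆ v∈ (bag⊆ b∈ v∈b) v∉ w∈ (bag⊆ b′∈ w∈b)) P′∈

    link-valid : ∀ {σ} τ → I σ τ → Valid (link (root (core σ)) τ)
    link-valid nil i = nil
    link-valid {σ} (node B l r) i = node (link-valid l (toˡ i)) (link-valid r (toʳ i))
      (λ P∈l P∈r → ∪ʳ {p = root (core σ)} (meet-lr (link⊆ P∈l) (link⊆ P∈r)))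
      (λ P∈X P∈l → in-root (in-tops (toˡ i) right P∈X (link⊆ P∈l)) P∈l)
      (λ P∈X P∈r → in-root (in-tops (toʳ i) left P∈X (link⊆ P∈r)) P∈r)
      where
      meet-lr : ∀ {P} → P ∈ tops B ⊎ P ∈ᵛ core l → P ∈ tops B ⊎ P ∈ᵛ core r → P ∈ tops B
      meet-lr (inj₁ P∈) _ = P∈
      meet-lr (inj₂ _) (inj₁ P∈) = P∈
      meet-lr (inj₂ P∈l) (inj₂ P∈r) = core-meet (toˡ i) (left P∈r) P∈l

      in-tops : ∀ {x y z P} → I (node B x y) z → (P ∈ᵛ core σ → P ∈ᵛ core (node B x y)) →
        P ∈ root (core σ) ∪ tops B → P ∈ tops B ⊎ P ∈ᵛ core z → P ∈ tops B
      in-tops j σ⊆ P∈X (inj₁ P∈) = P∈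
      in-tops j σ⊆ P∈X (inj₂ P∈z) with ∪⁻ {p = root (core σ)} P∈X
      ... | inj₁ P∈σ = core-meet j (σ⊆ (root⊆ (core σ) P∈σ)) P∈z
      ... | inj₂ P∈  = P∈

      in-root : ∀ {z P} → P ∈ tops B → P ∈ᵛ link (tops B) z → P ∈ root (link (tops B) z)
      in-root {node _ _ _} P∈ _ = ∪ˡ P∈

    -- Descent with the invariant that one undominated set covers `H P` behind the current edge. If
    -- a subtree holds a vertex of `H P` outside the dominator `P′`, everything of `H P` behind that
    -- subtree lies in `H P′`, which restores the invariant; if neither does, the current bag
    -- suffices.
    home : ∀ {σ B l r} P → I σ (node B l r) →
      (∀ {v} → v ∈ H P → v ∈ᵛ σ → ∃ λ P′ → P′ ∈ root (core σ) × v ∈ H P′) →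
      ∃ λ X → X ∈ᵇ link (root (core σ)) (node B l r) × (∀ {v} → v ∈ H P → ∃ λ P′ → P′ ∈ X × v ∈ H P′)
    home {σ} {B} {l} {r} P i σ⊆ with dominate B P
    ... | P′ , P′∈ , _ , B⊆ with escapes l | escapes r
      where
      escapes : ∀ z → Dec (∃ λ v → v ∈ᵛ z × v ∈ H P × v ∉ H P′)
      escapes z = Fin.any? λ v → (v ∈ᵛ? z) ×-dec (v ∈? H P) ×-dec ¬? (v ∈? H P′)
    ...   | yes (v , v∈l , v∈ , v∉) | _ with l
    ...     | l′@(node _ _ _) =
      let X , X∈ , X⊇ = home P (toˡ i) (λ w∈ w∈σ → P′ , P′∈ , back w∈ w∈σ) in X , left X∈ , X⊇
      where
      back : ∀ {w} → w ∈ H P → w ∈ᵛ node B r σ → w ∈ H P′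
      back {w} w∈ w∈σ with w ∈? H P′
      ... | yes w∈′ = w∈′
      ... | no w∉ = ⊥-elim (v∉ (one-sided (toˡ i) B⊆ w∈ w∈σ w∉ v∈ v∈l))
    home {σ} {B} {l} {r} P i σ⊆ | P′ , P′∈ , _ , B⊆ | no _ | yes (v , v∈r , v∈ , v∉) with r
    ...     | r′@(node _ _ _) =
      let X , X∈ , X⊇ = home P (toʳ i) (λ w∈ w∈σ → P′ , P′∈ , back w∈ w∈σ) in X , right X∈ , X⊇
      where
      back : ∀ {w} → w ∈ H P → w ∈ᵛ node B σ l → w ∈ H P′
      back {w} w∈ w∈σ with w ∈? H P′
      ... | yes w∈′ = w∈′
      ... | no w∉ = ⊥-elim (v∉ (one-sided (toʳ i) B⊆ w∈ w∈σ w∉ v∈ v∈r))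
    home {σ} {B} {l} {r} P i σ⊆ | P′ , P′∈ , _ , B⊆ | no ∉l | no ∉r =
      root (core σ) ∪ tops B , top , covered
      where
      within : ∀ {z v} → ¬ (∃ λ v → v ∈ᵛ z × v ∈ H P × v ∉ H P′) → v ∈ H P → v ∈ᵛ z → v ∈ H P′
      within {v = v} none v∈ v∈z = decidable-stable (v ∈? H P′) λ v∉ → none (v , v∈z , v∈ , v∉)

      covered : ∀ {v} → v ∈ H P → ∃ λ P″ → P″ ∈ root (core σ) ∪ tops B × v ∈ H P″
      covered v∈ with total i v∈
      ... | inj₁ v∈σ = let P″ , P″∈ , v∈″ = σ⊆ v∈ v∈σ in P″ , ∪ˡ P″∈ , v∈″
      ... | inj₂ (top v∈B)   = P′ , ∪ʳ {p = root (core σ)} P′∈ , B⊆ v∈B v∈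
      ... | inj₂ (left v∈l)  = P′ , ∪ʳ {p = root (core σ)} P′∈ , within ∉l v∈ v∈l
      ... | inj₂ (right v∈r) = P′ , ∪ʳ {p = root (core σ)} P′∈ , within ∉r v∈ v∈r

    -- Connectivity of the undominated members that meet a fixed set

    module _ {X : Fin n → Set} (X⊆ : ∀ {v} → X v → ∃ λ P → v ∈ H P)
             (sepX : ∀ {σ τ} → I σ τ → Sep X σ τ) where

      Hits : Fin h → Set
      Hits P = ∃ λ v → v ∈ H P × X v

      -- In the main case `X` has a vertex `w` in `B`; a member containing `w` exists by `X⊆`, and
      -- its dominator at `B` still contains `w`.
      cross-child : ∀ {B x y z P P′} → I (node B x y) z → P ∈ᵛ core z → Hits P → Hits P′ →
        (∀ {v} → v ∈ H P′ → X v → v ∈ᵛ node B x y ⊎ (∃ λ Q → Q ∈ tops B × Hits Q)) →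
        ∃ λ Q → Q ∈ tops B × Hits Q
      cross-child {B} i P∈ (v , v∈ , xv) (v′ , v′∈ , xv′) near with near v′∈ xv′
      ... | inj₂ found = found
      ... | inj₁ v′∈σ with total i v∈
      ...   | inj₁ v∈σ = let Q , Q∈ , v∈Q = transfer i P∈ v∈ v∈σ in Q , Q∈ , v , v∈Q , xv
      ...   | inj₂ v∈z =
        let w , xw , w∈σ , w∈z = sepX i xv′ xv v′∈σ v∈z
            P₃ , w∈P₃ = X⊆ xw
            Q , Q∈ , _ , B⊆ = dominate B P₃
        in Q , Q∈ , w , B⊆ (meet i w∈σ w∈z) w∈P₃ , xw

      -- Used at the child edge below which `P` is undominated: vertices of `P′` in `τ` are behind
      -- that edge, and those in `σ` are handed to the root by `transfer`.
      cross : ∀ {σ τ P P′} → I σ τ → P ∈ᵛ core σ → Hits P → P′ ∈ᵛ core τ → Hits P′ →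
        ∃ λ Q → Q ∈ root (core σ) × Hits Q
      cross {node B x y} {τ} {P} {P′} i P∈ hP P′∈ hP′ = go P∈
        where
        near : ∀ {x′ y′ v} → (v ∈ᵛ τ → v ∈ᵛ node B x′ y′) → v ∈ H P′ → X v →
          v ∈ᵛ node B x′ y′ ⊎ (∃ λ Q → Q ∈ tops B × Hits Q)
        near τ⊆ v∈ xv with total i v∈
        ... | inj₂ v∈τ = inj₁ (τ⊆ v∈τ)
        ... | inj₁ v∈σ = let Q , Q∈ , v∈Q = transfer i P′∈ v∈ v∈σ in inj₂ (Q , Q∈ , _ , v∈Q , xv)

        go : P ∈ᵛ core (node B x y) → ∃ λ Q → Q ∈ tops B × Hits Q
        go (top P∈B)   = P , P∈B , hP
        go (left P∈x)  = cross-child (toˡ (flip i)) P∈x hP hP′ (near right)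
        go (right P∈y) = cross-child (toʳ (flip i)) P∈y hP hP′ (near left)

      module _ (Q : Graph h) where

        Linked : Tree h → Set
        Linked T = ∀ {Y P P′} → Y ∈ᵇ T → P ∈ Y → P′ ∈ Y → P ≢ P′ → Adj Q P P′

        link-step : ∀ {T Y P P′} → Linked T → Y ∈ᵇ T → P ∈ Y → P′ ∈ Y → Hits P → Hits P′ → Walk Q Hits P P′
        link-step {P = P} {P′} adj Y∈ P∈ P′∈ hP hP′ with P Fin.≟ P′
        ... | yes refl = here hP
        ... | no P≢P′  = step hP (adj Y∈ P∈ P′∈ P≢P′) (here hP′)

        walk-to-root : ∀ {σ m B l r P P₀} → I σ (node B l r) → Linked (link m (node B l r)) →
          P ∈ᵛ core (node B l r) → Hits P → P₀ ∈ tops B → Hits P₀ → Walk Q Hits P P₀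
        walk-to-child : ∀ {B x y z P P₀} → I (node B x y) z → Linked (link (tops B) z) →
          P ∈ᵛ core z → Hits P → P₀ ∈ tops B → Hits P₀ → Walk Q Hits P P₀

        walk-to-root {m = m} i adj (top P∈) hP P₀∈ hP₀ =
          link-step adj top (∪ʳ {p = m} P∈) (∪ʳ {p = m} P₀∈) hP hP₀
        walk-to-root i adj (left P∈) hP P₀∈ hP₀  = walk-to-child (toˡ i) (adj ∘ left) P∈ hP P₀∈ hP₀
        walk-to-root i adj (right P∈) hP P₀∈ hP₀ = walk-to-child (toʳ i) (adj ∘ right) P∈ hP P₀∈ hP₀

        walk-to-child {B} {z = node B′ _ _} i adj P∈ hP P₀∈ hP₀ =
          -- `P₁` is undominated at the child and `P₀` at its parent; the joined bag of `link` makes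
          -- them adjacent.
          let P₁ , P₁∈ , hP₁ = cross (flip i) P∈ hP (top P₀∈) hP₀ in
          walk-to-root i adj P∈ hP P₁∈ hP₁ ++ʷ link-step adj top (∪ʳ {p = tops B} P₁∈) (∪ˡ P₀∈) hP₁ hP₀

        -- Two members below the same child are left to the recursion; otherwise some hitting member
        -- at the root, found by `cross` if need be, is joined to both.
        core-walk : ∀ {σ m} τ {P P′} → I σ τ → Linked (link m τ) →
          P ∈ᵛ core τ → Hits P → P′ ∈ᵛ core τ → Hits P′ → Walk Q Hits P P′
        core-walk {σ} {m} (node B l r) {P} {P′} i adj P∈ hP P′∈ hP′ = go P∈ P′∈
          where
          via : (∃ λ P₀ → P₀ ∈ tops B × Hits P₀) → Walk Q Hits P P′
          via (P₀ , P₀∈ , hP₀) = walk-to-root {m = m} i adj P∈ hP P₀∈ hP₀ ++ʷ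
            reverseʷ (walk-to-root {m = m} i adj P′∈ hP′ P₀∈ hP₀)

          go : P ∈ᵛ core (node B l r) → P′ ∈ᵛ core (node B l r) → Walk Q Hits P P′
          go (top P∈B)   _            = via (P , P∈B , hP)
          go (left _)    (top P′∈B)   = via (P′ , P′∈B , hP′)
          go (right _)   (top P′∈B)   = via (P′ , P′∈B , hP′)
          go (left P∈l)  (left P′∈l)  = core-walk l (toˡ i) (adj ∘ left) P∈l hP P′∈l hP′
          go (right P∈r) (right P′∈r) = core-walk r (toʳ i) (adj ∘ right) P∈r hP P′∈r hP′
          go (left P∈l)  (right P′∈r) = via (cross (toˡ i) (left P′∈r) hP′ P∈l hP)
          go (right P∈r) (left P′∈l)  = via (cross (toˡ i) (left P∈r) hP P′∈l hP′)

-- Representatives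

module Primal {n k : ℕ} (C : Subset n) (K : Fin k → Subset n) where

  far : Tree n → Tree n → Subset n
  far σ τ = verts τ ∩ ∁ (verts σ)

  -- The vertices common to both sides all lie in `root τ`; written as part of one bag, the set
  -- visibly has few subsets.
  adhesion : Tree n → Tree n → Subset n
  adhesion σ τ = root τ ∩ verts σ

  Beyond : Tree n → Tree n → Fin n → Set
  Beyond σ τ v = v ∈ᵛ τ × ¬ v ∈ᵛ σ

  beyond? : ∀ σ τ v → Dec (Beyond σ τ v)
  beyond? σ τ v = (v ∈ᵛ? τ) ×-dec ¬? (v ∈ᵛ? σ)

  ∈far⁺ : ∀ {σ τ v} → Beyond σ τ v → v ∈ far σ τ
  ∈far⁺ {σ} {τ} (v∈τ , v∉σ) = ∩⁺ (∈-setOf⁺ (_∈ᵛ? τ) v∈τ) (x∉p⇒x∈∁p (v∉σ ∘ ∈-setOf⁻ (_∈ᵛ? σ)))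

  ∈far⁻ : ∀ {σ τ v} → v ∈ far σ τ → Beyond σ τ v
  ∈far⁻ {σ} {τ} v∈ = let v∈τ , v∈∁σ = ∩⁻ {p = verts τ} v∈ in
    ∈-setOf⁻ (_∈ᵛ? τ) v∈τ , x∈∁p⇒x∉p v∈∁σ ∘ ∈-setOf⁺ (_∈ᵛ? σ)

  size : Tree n → Tree n → Fin k → ℕ
  size σ τ j = ∣ K j ∩ far σ τ ∣

  Alive : Tree n → Tree n → Fin k → Set
  Alive σ τ j = ∃ λ v → v ∈ K j × v ∈ C × Beyond σ τ v

  InClass : Tree n → Tree n → Subset n → Fin k → Set
  InClass σ τ Z j = K j ∩ adhesion σ τ ≡ Z × Alive σ τ j

  inClass? : ∀ σ τ Z j → Dec (InClass σ τ Z j)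
  inClass? σ τ Z j = ≡-dec Bool._≟_ _ _ ×-dec Fin.any? λ v → (v ∈? K j) ×-dec (v ∈? C) ×-dec beyond? σ τ v

  Minimal : Tree n → Tree n → Subset n → Fin k → Set
  Minimal σ τ Z j = InClass σ τ Z j × (∀ j′ → InClass σ τ Z j′ → size σ τ j ≤ size σ τ j′)

  -- The minimal member `j` stays existential, which lets `inherit` pass from `M` to another minimal
  -- member `N`.
  Rep : Tree n → Tree n → Subset n → Fin n → Set
  Rep σ τ Z v = v ∈ C × Beyond σ τ v × ∃ λ j → v ∈ K j × Minimal σ τ Z j

  rep? : ∀ σ τ Z v → Dec (Rep σ τ Z v)
  rep? σ τ Z v = (v ∈? C) ×-dec beyond? σ τ v ×-dec Fin.any? λ j → (v ∈? K j) ×-dec inClass? σ τ Z j ×-dec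
    Fin.all? λ j′ → inClass? σ τ Z j′ →-dec (size σ τ j ℕ.≤? size σ τ j′)

  -- Representatives are taken only from the next bag and from the representatives of the two next
  -- edges. Each is thus carried through consecutive bags until one contains it, which preserves
  -- running intersection. That suitable candidates exist is `reps-complete`.
  reps : Tree n → Tree n → Subset n
  candidates : Subset n → Tree n → Tree n → Tree n → Subset n
  available? : ∀ σ B l r Z → Dec (∃ λ v → v ∈ candidates B l r σ × Rep σ (node B l r) Z v)

  candidates B l r σ = B ∪ (reps (node B r σ) l ∪ reps (node B σ l) r)

  available? σ B l r Z = Fin.any? λ v → (v ∈? candidates B l r σ) ×-dec rep? σ (node B l r) Z v

  reps σ nil          = ⊥
  reps σ (node B l r) = choose (available? σ B l r) (subsets (adhesion σ (node B l r)))

  ∣reps∣≤ : ∀ {s} σ τ → ∣ root τ ∣ ≤ s → ∣ reps σ τ ∣ ≤ 2 ^ s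
  ∣reps∣≤ σ nil _ = ∣⊥∣≤ n
  ∣reps∣≤ σ τ@(node B l r) B≤ = ℕ.≤-trans (∣choose-subsets∣≤2^ (available? σ B l r) (adhesion σ τ))
    (ℕ.^-monoʳ-≤ 2 (ℕ.≤-trans (∣p∩q∣≤∣p∣ B (verts σ)) B≤))

  reps-sound : ∀ σ τ {v} → v ∈ reps σ τ → v ∈ C × Beyond σ τ v
  reps-sound σ nil v∈ = ⊥-elim (∉⊥ v∈)
  reps-sound σ (node B l r) v∈ with choose-sound (available? σ B l r) (subsets (adhesion σ (node B l r))) v∈
  ... | _ , _ , _ , v∈C , beyond , _ = v∈C , beyond

  reps-local : ∀ {σ B l r v} → v ∈ reps σ (node B l r) →
    v ∈ B ⊎ v ∈ reps (node B r σ) l ⊎ v ∈ reps (node B σ l) r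
  reps-local {σ} {B} {l} {r} v∈ with choose-sound (available? σ B l r) (subsets (adhesion σ (node B l r))) v∈
  ... | _ , _ , v∈cand , _ = Sum.map₂ (∪⁻ {p = reps (node B r σ) l}) (∪⁻ {p = B} v∈cand)

  module _ {I : Tree n → Tree n → Set} (reroot : Rerootable I)
           (sep : ∀ {σ τ} → I σ τ → ∀ a b → Sep (λ v → v ∈ K a × v ∉ K b) σ τ) where

    open Rerootable reroot

    same-trace : ∀ {σ τ a b v} → I σ τ → K a ∩ adhesion σ τ ≡ K b ∩ adhesion σ τ →
      v ∈ᵛ σ → v ∈ᵛ τ → v ∈ K a → v ∈ K b
    same-trace {σ} {τ} {a} {b} {v} i eq v∈σ v∈τ v∈ =
      proj₁ (∩⁻ {p = K b} (subst (v ∈_) eq (∩⁺ v∈ (∩⁺ (meet (flip i) v∈τ v∈σ) (∈-setOf⁺ (_∈ᵛ? σ) v∈σ)))))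

    -- With `u` in the difference on one side, a `v` in it on the other would yield a common vertex
    -- of the difference, against the equal traces.
    near-⊆ : ∀ {σ τ a b u v} → I σ τ → K a ∩ adhesion σ τ ≡ K b ∩ adhesion σ τ →
      u ∈ᵛ τ → u ∈ K a → u ∉ K b → v ∈ᵛ σ → v ∈ K a → v ∈ K b
    near-⊆ {a = a} {b} {v = v} i eq u∈τ u∈ u∉ v∈σ v∈ with v ∈? K b
    ... | yes v∈b = v∈b
    ... | no v∉ = let w , (w∈ , w∉) , w∈σ , w∈τ = sep i a b (v∈ , v∉) (u∈ , u∉) v∈σ u∈τ in
      ⊥-elim (w∉ (same-trace i eq w∈σ w∈τ w∈))

    -- A member j of the class that misses r has a vertex outside M beyond the edge, as it would
    -- otherwise be smaller than M there; so both differences of M and j live beyond the edge.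
    exchange : ∀ {σ τ Z M j r} → I σ τ → Beyond σ τ r → r ∈ K M → Minimal σ τ Z M → InClass σ τ Z j → r ∉ K j →
      (∀ {v} → v ∈ᵛ σ → (v ∈ K M → v ∈ K j) × (v ∈ K j → v ∈ K M)) ×
      ∃ λ w → w ∈ K j × w ∉ K M × Beyond σ τ w
    exchange {σ} {τ} {Z} {M} {j} {r} i br r∈ ((eqM , _) , minM) cls@(eqj , _) r∉
      with Fin.any? (λ w → (w ∈? K j) ×-dec ¬? (w ∈? K M) ×-dec beyond? σ τ w)
    ... | yes (w , w∈ , w∉ , bw) =
      (λ v∈σ → near-⊆ i eq (proj₁ br) r∈ r∉ v∈σ , near-⊆ i (≡-sym eq) (proj₁ bw) w∈ w∉ v∈σ) ,
      w , w∈ , w∉ , bw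
      where
      eq : K M ∩ adhesion σ τ ≡ K j ∩ adhesion σ τ
      eq = trans eqM (≡-sym eqj)
    ... | no none = ⊥-elim (ℕ.<⇒≱ (p⊂q⇒∣p∣<∣q∣ smaller) (minM j cls))
      where
      smaller : (K j ∩ far σ τ) ⊂ (K M ∩ far σ τ)
      smaller = (λ {v} v∈ → let v∈j , v∈F = ∩⁻ {p = K j} v∈ in
                  ∩⁺ (decidable-stable (v ∈? K M) λ v∉ → none (v , v∈j , v∉ , ∈far⁻ v∈F)) v∈F)
              , r , ∩⁺ r∈ (∈far⁺ br) , r∉ ∘ proj₁ ∘ ∩⁻ {p = K j}

    -- The pair `σ′`, `τ′` is the next edge outward. If `r` is not in `K M`, then by `exchange` `N`
    -- and `M` agree on `σ′`. So `N` has the trace of `M` at the first edge and is no larger beyond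
    -- it: they agree outside `F′`, and inside `N` is minimal. Hence `N`, which contains `r`, is
    -- minimal at the first edge too.
    inherit : ∀ {σ τ σ′ τ′ Z Z′ M N r} → I σ τ → I σ′ τ′ →
      (∀ {v} → Beyond σ′ τ′ v → Beyond σ τ v) → (∀ {v} → v ∈ᵛ τ → v ∈ᵛ σ′ ⊎ Beyond σ′ τ′ v) →
      (∀ {v} → v ∈ root τ → v ∈ᵛ σ′) →
      Minimal σ τ Z M → InClass σ′ τ′ Z′ M →
      r ∈ C → Beyond σ′ τ′ r → r ∈ K N → Minimal σ′ τ′ Z′ N → Rep σ τ Z r
    inherit {σ} {τ} {σ′} {τ′} {Z} {Z′} {M} {N} {r} i i′ F′⊆F τ⊆ root⊆σ′ minM@((eqM , _) , leM) clsM r∈C br r∈N minN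
      with r ∈? K M
    ... | yes r∈M = r∈C , F′⊆F br , M , r∈M , minM
    ... | no r∉M = r∈C , F′⊆F br , N , r∈N , (trans (⊆-antisym N⊆M M⊆N) eqM , r , r∈N , r∈C , F′⊆F br) ,
        λ j′ cls → ℕ.≤-trans N≤M (leM j′ cls)
      where
      agree : ∀ {v} → v ∈ᵛ σ′ → (v ∈ K N → v ∈ K M) × (v ∈ K M → v ∈ K N)
      agree = proj₁ (exchange i′ br r∈N minN clsM r∉M)

      N⊆M : K N ∩ adhesion σ τ ⊆ K M ∩ adhesion σ τ
      N⊆M v∈ = let v∈N , v∈A = ∩⁻ {p = K N} v∈ in
        ∩⁺ (proj₁ (agree (root⊆σ′ (proj₁ (∩⁻ {p = root τ} v∈A)))) v∈N) v∈A

      M⊆N : K M ∩ adhesion σ τ ⊆ K N ∩ adhesion σ τ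
      M⊆N v∈ = let v∈M , v∈A = ∩⁻ {p = K M} v∈ in
        ∩⁺ (proj₂ (agree (root⊆σ′ (proj₁ (∩⁻ {p = root τ} v∈A)))) v∈M) v∈A

      F F′ : Subset n
      F = far σ τ
      F′ = far σ′ τ′

      inside≤ : ∣ (K N ∩ F) ∩ F′ ∣ ≤ ∣ (K M ∩ F) ∩ F′ ∣
      inside≤ = ℕ.≤-trans
        (p⊆q⇒∣p∣≤∣q∣ λ v∈ → let v∈′ , v∈F′ = ∩⁻ {p = K N ∩ F} v∈ in ∩⁺ (proj₁ (∩⁻ {p = K N} v∈′)) v∈F′)
        (ℕ.≤-trans (proj₂ minN M clsM)
          (p⊆q⇒∣p∣≤∣q∣ λ v∈ → let v∈M , v∈F′ = ∩⁻ {p = K M} v∈ in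
            ∩⁺ (∩⁺ v∈M (∈far⁺ (F′⊆F (∈far⁻ v∈F′)))) v∈F′))

      outside≤ : ∣ (K N ∩ F) ∩ ∁ F′ ∣ ≤ ∣ (K M ∩ F) ∩ ∁ F′ ∣
      outside≤ = p⊆q⇒∣p∣≤∣q∣ λ v∈ →
        let v∈′ , v∈∁F′ = ∩⁻ {p = K N ∩ F} v∈
            v∈N , v∈F = ∩⁻ {p = K N} v∈′
            v∈σ′ = [ (λ v∈σ′ → v∈σ′) , (λ b → ⊥-elim (x∈∁p⇒x∉p v∈∁F′ (∈far⁺ b))) ]′ (τ⊆ (proj₁ (∈far⁻ {σ} v∈F)))
        in ∩⁺ (∩⁺ (proj₁ (agree v∈σ′) v∈N) v∈F) v∈∁F′

      N≤M : size σ τ N ≤ size σ τ M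
      N≤M = begin
        ∣ K N ∩ F ∣                                   ≡⟨ ∣p∣≡∣p∩q∣+∣p∩∁q∣ (K N ∩ F) F′ ⟩
        ∣ (K N ∩ F) ∩ F′ ∣ + ∣ (K N ∩ F) ∩ ∁ F′ ∣     ≤⟨ ℕ.+-mono-≤ inside≤ outside≤ ⟩
        ∣ (K M ∩ F) ∩ F′ ∣ + ∣ (K M ∩ F) ∩ ∁ F′ ∣     ≡⟨ ∣p∣≡∣p∩q∣+∣p∩∁q∣ (K M ∩ F) F′ ⟨
        ∣ K M ∩ F ∣                                   ∎
        where open ℕ.≤-Reasoning

    -- A covered vertex of a minimal `M` is a candidate if it lies in `B`. Otherwise `M` is alive
    -- beyond a child edge, and a representative of its class there serves here by `inherit`.
    reps-complete : ∀ {σ} τ → I σ τ → ∀ j → Alive σ τ j →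
      ∃ λ v → v ∈ reps σ τ × Rep σ τ (K j ∩ adhesion σ τ) v
    reps-complete nil i j (v , _ , _ , () , _)
    reps-complete {σ} τ@(node B l r) i j alive
      with least (inClass? σ τ (K j ∩ adhesion σ τ)) (size σ τ) (j , refl , alive)
    ... | M , minM@((_ , v , v∈M , v∈C , v∈τ , v∉σ) , _) =
      let r , r∈ , _ , rep = choose-complete (available? σ B l r) (∩∈subsets (K j) (adhesion σ τ)) (found v∈τ)
      in r , r∈ , rep
      where
      Found : Set
      Found = ∃ λ v → v ∈ candidates B l r σ × Rep σ τ (K j ∩ adhesion σ τ) v

      v∈ : Beyond σ τ v
      v∈ = v∈τ , v∉σ

      found : v ∈ᵛ τ → Found
      found (top v∈B) = v , ∪ˡ v∈B , v∈C , v∈ , M , v∈M , minM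
      found (left v∈l) with v ∈? B
      ... | yes v∈B = v , ∪ˡ v∈B , v∈C , v∈ , M , v∈M , minM
      ... | no v∉B =
        let aliveM = v , v∈M , v∈C , v∈l , v∉B ∘ λ v∈′ → meet (toˡ i) v∈′ v∈l
            r , r∈ , r∈C , br , N , r∈N , minN = reps-complete l (toˡ i) M aliveM
        in r , ∪ʳ {p = B} (∪ˡ r∈) ,
           inherit i (toˡ i)
             (λ (v∈l , v∉) → left v∈l , v∉ ∘ right)
             (λ where (top v∈B) → inj₁ (top v∈B)
                      {v} (left v∈l) → Sum.map₂ (v∈l ,_) (toSum (v ∈ᵛ? node B _ σ))
                      (right v∈r) → inj₁ (left v∈r))
             top minM (refl , aliveM) r∈C br r∈N minN
      found (right v∈r) with v ∈? B
      ... | yes v∈B = v , ∪ˡ v∈B , v∈C , v∈ , M , v∈M , minM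
      ... | no v∉B =
        let aliveM = v , v∈M , v∈C , v∈r , v∉B ∘ λ v∈′ → meet (toʳ i) v∈′ v∈r
            r′ , r∈ , r∈C , br , N , r∈N , minN = reps-complete r (toʳ i) M aliveM
        in r′ , ∪ʳ {p = B} (∪ʳ {p = reps (node B r σ) l} r∈) ,
           inherit i (toʳ i)
             (λ (v∈r , v∉) → right v∈r , v∉ ∘ left)
             (λ where (top v∈B) → inj₁ (top v∈B)
                      (left v∈l) → inj₁ (right v∈l)
                      {v} (right v∈r) → Sum.map₂ (v∈r ,_) (toSum (v ∈ᵛ? node B σ l)))
             top minM (refl , aliveM) r∈C br r∈N minN

    crossing : ∀ {σ τ j u v} → I σ τ → u ∈ K j × u ∈ C → v ∈ K j × v ∈ C → u ∈ᵛ σ → v ∈ᵛ τ →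
      ∃ λ w → (w ∈ K j × w ∈ C) × (w ∈ᵛ σ × w ∈ᵛ τ ⊎ w ∈ reps σ τ ⊎ w ∈ reps τ σ)
    crossing {σ} {τ} {j} {u} {v} i (u∈ , u∈C) (v∈ , v∈C) u∈σ v∈τ with u ∈ᵛ? τ | v ∈ᵛ? σ
    ... | yes u∈τ | _ = u , (u∈ , u∈C) , inj₁ (u∈σ , u∈τ)
    ... | no _ | yes v∈σ = v , (v∈ , v∈C) , inj₁ (v∈σ , v∈τ)
    ... | no u∉τ | no v∉σ
      with reps-complete τ i j (v , v∈ , v∈C , v∈τ , v∉σ) | reps-complete σ (flip i) j (u , u∈ , u∈C , u∈σ , u∉τ)
    ...   | r , r∈ , r∈C , br , M , r∈M , minM | r′ , r′∈ , r′∈C , br′ , N , r′∈N , minN with r ∈? K j | r′ ∈? K j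
    ...     | yes r∈j | _ = r , (r∈j , r∈C) , inj₂ (inj₁ r∈)
    ...     | no _ | yes r′∈j = r′ , (r′∈j , r′∈C) , inj₂ (inj₂ r′∈)
    ...     | no r∉j | no r′∉j =
      -- On `σ` the set `K j` agrees with `K M`, on `τ` with `K N`. So `w` and `r` are vertices of
      -- `K M` outside `K N` on the two sides, while a vertex `z` common to both sides cannot be
      -- one.
      let agreeM , _ = exchange i br r∈M minM (refl , v , v∈ , v∈C , v∈τ , v∉σ) r∉j
          agreeN , w , w∈j , w∉N , w∈σ , _ = exchange (flip i) br′ r′∈N minN (refl , u , u∈ , u∈C , u∈σ , u∉τ) r′∉j
          z , (z∈M , z∉N) , z∈σ , z∈τ =
            sep i M N (proj₂ (agreeM w∈σ) w∈j , w∉N) (r∈M , r∉j ∘ proj₁ (agreeN (proj₁ br))) w∈σ (proj₁ br)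
      in ⊥-elim (z∉N (proj₂ (agreeN z∈τ) (proj₁ (agreeM z∈σ) z∈M)))

  -- Bags augmented by representatives

  primBag : Tree n → Subset n → Tree n → Tree n → Subset n
  primBag σ B l r = (B ∩ C) ∪ (reps (node B l r) σ ∪ (reps (node B r σ) l ∪ reps (node B σ l) r))

  prim : Tree n → Tree n → Tree n
  prim σ nil          = nil
  prim σ (node B l r) = node (primBag σ B l r) (prim (node B r σ) l) (prim (node B σ l) r)

  -- The representatives come from the three edges leaving the node, so the bag does not depend on
  -- which neighbour is the parent. This is what makes the augmented tree rerootable.
  primBag-cyclic : ∀ σ B l r → primBag σ B l r ≡ primBag l B r σ
  primBag-cyclic σ B l r = cong ((B ∩ C) ∪_) (trans (∪-comm _ _) (∪-assoc _ _ _))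

  ∣prim∣≤ : ∀ {s σ} τ → ∣ root σ ∣ ≤ s → (∀ {B} → B ∈ᵇ τ → ∣ B ∣ ≤ s) →
    ∀ {B} → B ∈ᵇ prim σ τ → ∣ B ∣ ≤ s + (2 ^ s + (2 ^ s + 2 ^ s))
  ∣prim∣≤ {s} {σ} τ@(node B l r) σ≤ τ≤ top =
    ∪-≤ (B ∩ C) _ (ℕ.≤-trans (∣p∩q∣≤∣p∣ B C) (τ≤ top))
      (∪-≤ (reps τ σ) _ (∣reps∣≤ τ σ σ≤)
        (∪-≤ (reps (node B r σ) l) _
          (∣reps∣≤ (node B r σ) l (child≤ l (τ≤ ∘ left)))
          (∣reps∣≤ (node B σ l) r (child≤ r (τ≤ ∘ right)))))
    where
    ∪-≤ : ∀ (p q : Subset n) {a b} → ∣ p ∣ ≤ a → ∣ q ∣ ≤ b → ∣ p ∪ q ∣ ≤ a + b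
    ∪-≤ p q p≤ q≤ = ℕ.≤-trans (∣p∪q∣≤∣p∣+∣q∣ p q) (ℕ.+-mono-≤ p≤ q≤)

    child≤ : ∀ z → (∀ {B} → B ∈ᵇ z → ∣ B ∣ ≤ s) → ∣ root z ∣ ≤ s
    child≤ nil _            = ∣⊥∣≤ n
    child≤ (node _ _ _) z≤ = z≤ top
  ∣prim∣≤ (node B l r) σ≤ τ≤ (left B∈)  = ∣prim∣≤ l (τ≤ top) (τ≤ ∘ left) B∈
  ∣prim∣≤ (node B l r) σ≤ τ≤ (right B∈) = ∣prim∣≤ r (τ≤ top) (τ≤ ∘ right) B∈

  prim-covers : ∀ {σ τ v} → v ∈ C → v ∈ᵛ τ → v ∈ᵛ prim σ τ
  prim-covers v∈C (top v∈)   = top (∪ˡ (∩⁺ v∈ v∈C))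
  prim-covers v∈C (left v∈)  = left (prim-covers v∈C v∈)
  prim-covers v∈C (right v∈) = right (prim-covers v∈C v∈)

  primBag⁻ : ∀ σ B l r {v} → v ∈ primBag σ B l r →
    (v ∈ B × v ∈ C) ⊎ v ∈ reps (node B l r) σ ⊎ v ∈ reps (node B r σ) l ⊎ v ∈ reps (node B σ l) r
  primBag⁻ σ B l r v∈ =
    Sum.map (∩⁻ {p = B}) (Sum.map₂ (∪⁻ {p = reps (node B r σ) l}) ∘ ∪⁻ {p = reps (node B l r) σ}) (∪⁻ {p = B ∩ C} v∈)

  prim⊆C : ∀ {σ} τ {v} → v ∈ᵛ prim σ τ → v ∈ C
  prim⊆C {σ} (node B l r) (top v∈) with primBag⁻ σ B l r v∈
  ... | inj₁ (_ , v∈C)         = v∈C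
  ... | inj₂ (inj₁ v∈′)        = proj₁ (reps-sound (node B l r) σ v∈′)
  ... | inj₂ (inj₂ (inj₁ v∈′)) = proj₁ (reps-sound (node B r σ) l v∈′)
  ... | inj₂ (inj₂ (inj₂ v∈′)) = proj₁ (reps-sound (node B σ l) r v∈′)
  prim⊆C (node B l r) (left v∈)  = prim⊆C l v∈
  prim⊆C (node B l r) (right v∈) = prim⊆C r v∈

  reps⊆far : ∀ σ τ {v} → v ∈ reps σ τ → v ∈ᵛ τ
  reps⊆far σ τ v∈ = proj₁ (proj₂ (reps-sound σ τ v∈))

  -- `reps-local` carries a representative pointing out of a child across the node: it is in `B`,
  -- lies in the sibling, or points on towards `σ`.
  prim-origin : ∀ {σ} τ {v} → v ∈ᵛ prim σ τ → v ∈ᵛ τ ⊎ v ∈ reps τ σ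
  prim-origin {σ} (node B l r) (top v∈) with primBag⁻ σ B l r v∈
  ... | inj₁ (v∈B , _)         = inj₁ (top v∈B)
  ... | inj₂ (inj₁ v∈σ)        = inj₂ v∈σ
  ... | inj₂ (inj₂ (inj₁ v∈l)) = inj₁ (left (reps⊆far (node B r σ) l v∈l))
  ... | inj₂ (inj₂ (inj₂ v∈r)) = inj₁ (right (reps⊆far (node B σ l) r v∈r))
  prim-origin {σ} (node B l r) (left v∈) with prim-origin l v∈
  ... | inj₁ v∈l = inj₁ (left v∈l)
  ... | inj₂ v∈′ with reps-local v∈′
  ...   | inj₁ v∈B        = inj₁ (top v∈B)
  ...   | inj₂ (inj₁ v∈r) = inj₁ (right (reps⊆far (node B σ l) r v∈r))
  ...   | inj₂ (inj₂ v∈σ) = inj₂ v∈σ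
  prim-origin {σ} (node B l r) (right v∈) with prim-origin r v∈
  ... | inj₁ v∈r = inj₁ (right v∈r)
  ... | inj₂ v∈′ with reps-local v∈′
  ...   | inj₁ v∈B        = inj₁ (top v∈B)
  ...   | inj₂ (inj₁ v∈σ) = inj₂ v∈σ
  ...   | inj₂ (inj₂ v∈l) = inj₁ (left (reps⊆far (node B r σ) l v∈l))

  reps-outward⊆root : ∀ σ B l r {v} → v ∈ reps (node B l r) σ → v ∈ primBag σ B l r
  reps-outward⊆root σ B l r v∈ = ∪ʳ {p = B ∩ C} (∪ˡ v∈)

  -- Bags receive representatives of outgoing edges only; by `reps-local` those of the entering edge
  -- are then present as well.
  reps-inward⊆root : ∀ σ B l r {v} → v ∈ reps σ (node B l r) → v ∈ primBag σ B l r
  reps-inward⊆root σ B l r v∈ with reps-local v∈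
  ... | inj₁ v∈B = ∪ˡ (∩⁺ v∈B (proj₁ (reps-sound σ (node B l r) v∈)))
  ... | inj₂ v∈′ = ∪ʳ {p = B ∩ C} (∪ʳ {p = reps (node B l r) σ} (x∈p∪q⁺ v∈′))

  reps-present : ∀ {σ τ u v} → u ∈ᵛ τ → v ∈ reps τ σ → v ∈ᵛ prim σ τ
  reps-present {σ} {node B l r} _ v∈ = top (reps-outward⊆root σ B l r v∈)

  module PrimSplit {I : Tree n → Tree n → Set} (reroot : Rerootable I) where

    open Rerootable reroot

    PrimI : Tree n → Tree n → Set
    PrimI σ′ τ′ = ∃ λ σ → ∃ λ τ → I σ τ × σ′ ≡ prim τ σ × τ′ ≡ prim σ τ

    prim-meet : ∀ {σ τ v} → I σ τ → v ∈ᵛ prim τ σ → v ∈ᵛ prim σ τ → v ∈ root (prim τ σ)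
    prim-meet {σ@(node B x y)} {τ} i v∈σ′ v∈τ′ with prim-origin σ v∈σ′ | prim-origin τ v∈τ′
    ... | inj₂ v∈ | _       = reps-outward⊆root τ B x y v∈
    ... | inj₁ _  | inj₂ v∈ = reps-inward⊆root τ B x y v∈
    ... | inj₁ v∈σ | inj₁ v∈τ = ∪ˡ (∩⁺ (meet i v∈σ v∈τ) (prim⊆C σ v∈σ′))

    prim-reroot : Rerootable PrimI
    prim-reroot = record
      { flip = λ (σ , τ , i , eσ , eτ) → τ , σ , flip i , eτ , eσ
      ; toˡ  = λ where
          (σ , node B l r , i , refl , refl) →
            node B r σ , l , toˡ i ,
            cong (λ b → node b (prim (node B σ l) r) (prim (node B l r) σ)) (primBag-cyclic σ B l r) , refl
      ; meet = λ where (σ , τ , i , refl , refl) → prim-meet i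
      }

    -- A representative is common to both augmented sides: it was added at the near end of its edge,
    -- and as a covered vertex it survives on the far side.
    prim-sep : ∀ {X : Fin n → Set} → (∀ {v} → X v → v ∈ C) →
      (∀ {σ τ u v} → I σ τ → X u → X v → u ∈ᵛ σ → v ∈ᵛ τ →
        ∃ λ w → X w × (w ∈ᵛ σ × w ∈ᵛ τ ⊎ w ∈ reps σ τ ⊎ w ∈ reps τ σ)) →
      ∀ {σ τ} → PrimI σ τ → Sep X σ τ
    prim-sep X⊆C cross (σ , τ , i , refl , refl) {u} {v} xu xv u∈ v∈ with prim-origin σ u∈ | prim-origin τ v∈
    ... | inj₂ u∈′ | _ = u , xu , u∈ , prim-covers (X⊆C xu) (reps⊆far σ τ u∈′)
    ... | inj₁ _ | inj₂ v∈′ = v , xv , prim-covers (X⊆C xv) (reps⊆far τ σ v∈′) , v∈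
    ... | inj₁ u∈σ | inj₁ v∈τ with cross i xu xv u∈σ v∈τ
    ...   | w , xw , inj₁ (w∈σ , w∈τ) = w , xw , prim-covers (X⊆C xw) w∈σ , prim-covers (X⊆C xw) w∈τ
    ...   | w , xw , inj₂ (inj₁ w∈) = w , xw , reps-present u∈σ w∈ , prim-covers (X⊆C xw) (reps⊆far σ τ w∈)
    ...   | w , xw , inj₂ (inj₂ w∈) = w , xw , prim-covers (X⊆C xw) (reps⊆far τ σ w∈) , reps-present v∈τ w∈

-- Decompositions built by adding leaves

-- The newest leaf is `zero` and older nodes shift by `suc`, so connectivity and acyclicity go by
-- induction on the leaves.
data Leafy (n : ℕ) : ℕ → Set where
  single : Subset n → Leafy n 1
  add    : ∀ {m} → Leafy n m → Fin m → Subset n → Leafy n (suc m)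

module _ {n : ℕ} where

  bagAt : ∀ {m} → Leafy n m → Fin m → Subset n
  bagAt (single B)  _       = B
  bagAt (add t p B) zero    = B
  bagAt (add t p B) (suc i) = bagAt t i

  LeafyAdj : ∀ {m} → Leafy n m → Fin m → Fin m → Set
  LeafyAdj (single _)  _       _       = Empty.⊥
  LeafyAdj (add t p B) zero    zero    = Empty.⊥
  LeafyAdj (add t p B) zero    (suc j) = j ≡ p
  LeafyAdj (add t p B) (suc i) zero    = i ≡ p
  LeafyAdj (add t p B) (suc i) (suc j) = LeafyAdj t i j

  leafyGraph : ∀ {m} → Leafy n m → Graph m
  leafyGraph t = record { Adj = LeafyAdj t ; sym = symm t ; irrefl = irr t }
    where
    symm : ∀ {m} (t : Leafy n m) {i j} → LeafyAdj t i j → LeafyAdj t j i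
    symm (add t p B) {zero}  {suc j} e = e
    symm (add t p B) {suc i} {zero}  e = e
    symm (add t p B) {suc i} {suc j} e = symm t e

    irr : ∀ {m} (t : Leafy n m) {i} → ¬ LeafyAdj t i i
    irr (add t p B) {suc i} e = irr t e

  Closed : ∀ {m} → Leafy n m → (Fin m → Set) → Set
  Closed (single _)  P = ⊤
  Closed (add t p B) P = Closed t (P ∘ suc) × (∀ {j} → P zero → P (suc j) → P (suc p))

  closed⇒connected : ∀ {m} (t : Leafy n m) {P} → Closed t P → InducedConnected (leafyGraph t) P
  closed⇒connected (single B) _ zero zero pu _ = here pu
  closed⇒connected (add t p B) {P} (cl , up) = go
    where
    lift : ∀ {i j} → Walk (leafyGraph t) (P ∘ suc) i j → Walk (leafyGraph (add t p B)) P (suc i) (suc j)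
    lift (here p)     = here p
    lift (step p e w) = step p e (lift w)

    from-leaf : ∀ j → P zero → P (suc j) → Walk (leafyGraph (add t p B)) P zero (suc j)
    from-leaf j p₀ pj = step p₀ refl (lift (closed⇒connected t cl p j (up p₀ pj) pj))

    go : InducedConnected (leafyGraph (add t p B)) P
    go zero    zero    p₀ _  = here p₀
    go zero    (suc j) p₀ pj = from-leaf j p₀ pj
    go (suc i) zero    pi p₀ = reverseʷ (from-leaf i p₀ pi)
    go (suc i) (suc j) pi pj = lift (closed⇒connected t cl i j pi pj)

  -- The only neighbour of the leaf would be both its predecessor and its successor on the cycle,
  -- against injectivity. The first and last positions are separate cases because of the closing
  -- edge.
  leaf-not-on-cycle : ∀ {m k} {t : Leafy n m} {p B} (c : Fin (3 + k) → Fin (suc m)) → Injective _≡_ _≡_ c →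
    (∀ (i : Fin (2 + k)) → LeafyAdj (add t p B) (c (inject₁ i)) (c (suc i))) →
    LeafyAdj (add t p B) (c (fromℕ (2 + k))) (c zero) → ∀ i → c i ≢ zero
  leaf-not-on-cycle {m} {k} {t} {p} {B} c inj adj close = off
    where
    after : ∀ {i j} → LeafyAdj (add t p B) i j → i ≡ zero → j ≡ suc p
    after {zero} {suc j} refl refl = refl

    before : ∀ {i j} → LeafyAdj (add t p B) i j → j ≡ zero → i ≡ suc p
    before {suc i} {zero} refl refl = refl

    off : ∀ i → c i ≢ zero
    off zero c₀ with inj (trans (after (adj zero) c₀) (≡-sym (before close c₀)))
    ... | ()
    off (suc j) cj with suc j Fin.≟ fromℕ (2 + k)
    ... | yes eq = last-not-first j eq
        (inj (trans (before (adj j) cj) (≡-sym (after close (trans (cong c (≡-sym eq)) cj)))))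
      where
      last-not-first : ∀ {k} (j : Fin (2 + k)) → suc j ≡ fromℕ (2 + k) → inject₁ j ≢ zero
      last-not-first zero ()
    ... | no ≢last = inject₁≢suc (inj (trans (before (adj j) cj)
        (≡-sym (after (adj (lower₁ (suc j) ≢last′)) (trans (cong c (Fin.inject₁-lower₁ (suc j) ≢last′)) cj)))))
      where
      ≢last′ : 2 + k ≢ toℕ (suc j)
      ≢last′ eq = ≢last (Fin.toℕ-injective (trans (≡-sym eq) (≡-sym (Fin.toℕ-fromℕ (2 + k)))))

      inject₁≢suc : inject₁ j ≢ suc (lower₁ (suc j) ≢last′)
      inject₁≢suc eq = ℕ.m≢1+m+n (toℕ j) {1} (trans (≡-sym (Fin.toℕ-inject₁ j))
        (trans (cong toℕ eq) (trans (cong suc (Fin.toℕ-lower₁ (suc j) ≢last′)) (cong suc (ℕ.+-comm 1 (toℕ j))))))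

  leafy-acyclic : ∀ {m} (t : Leafy n m) → ¬ HasCycle (leafyGraph t)
  leafy-acyclic (single _) (_ , _ , _ , _ , ())
  leafy-acyclic (add {m} t p B) (k , c , inj , adj , close) = leafy-acyclic t
    (k , c′ , (λ {i} {j} eq → inj (trans (≡-sym (c≡ i)) (trans (cong suc eq) (c≡ j)))) , (λ i → old (adj i)) , old close)
    where
    off : ∀ i → c i ≢ zero
    off = leaf-not-on-cycle {t = t} {p} {B} c inj adj close

    c′ : Fin (3 + k) → Fin m
    c′ i = punchOut (off i ∘ ≡-sym)

    c≡ : ∀ i → suc (c′ i) ≡ c i
    c≡ i = Fin.punchIn-punchOut (off i ∘ ≡-sym)

    old : ∀ {i j} → LeafyAdj (add t p B) (c i) (c j) → LeafyAdj t (c′ i) (c′ j)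
    old {i} {j} e = subst (λ a → LeafyAdj (add t p B) a (suc (c′ j))) (≡-sym (c≡ i))
      (subst (LeafyAdj (add t p B) (c i)) (≡-sym (c≡ j)) e)

  leafy-tree : ∀ {m} (t : Leafy n m) → IsTree (leafyGraph t)
  leafy-tree t = record { nonempty = first t ; connected = closed⇒connected t (all t) ; acyclic = leafy-acyclic t }
    where
    first : ∀ {m} → Leafy n m → Fin m
    first (single _)  = zero
    first (add _ _ _) = zero

    all : ∀ {m} (t : Leafy n m) → Closed t (λ _ → ⊤)
    all (single _)  = tt
    all (add t _ _) = all t , λ _ _ → tt

  Running : ∀ {m} → Leafy n m → Set
  Running (single _)  = ⊤
  Running (add t p B) = Running t × (∀ {j v} → v ∈ B → v ∈ bagAt t j → v ∈ bagAt t p)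

  running⇒closed : ∀ {m} (t : Leafy n m) → Running t → ∀ v → Closed t (λ i → v ∈ bagAt t i)
  running⇒closed (single _) _ v = tt
  running⇒closed (add t p B) (rt , up) v = running⇒closed t rt v , up

  record Grown {m : ℕ} (t : Leafy n m) (τ : Tree n) : Set where
    field
      {m⁺}   : ℕ
      t⁺     : Leafy n m⁺
      embed  : Fin m → Fin m⁺
      embed≡ : ∀ i → bagAt t⁺ (embed i) ≡ bagAt t i
      run    : Running t⁺
      from   : ∀ i → (∃ λ j → bagAt t⁺ i ≡ bagAt t j) ⊎ bagAt t⁺ i ∈ᵇ τ
      onto   : ∀ {B} → B ∈ᵇ τ → ∃ λ i → bagAt t⁺ i ≡ B

  -- The last hypothesis says that old bags and `τ` share vertices only across the edge from `p` to
  -- the root. The right subtree comes after the left one, so its parent is the shifted index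
  -- `L.embed zero`.
  grow : ∀ {m} (t : Leafy n m) p τ → Running t → Valid τ →
    (∀ {j v} → v ∈ bagAt t j → v ∈ᵛ τ → v ∈ bagAt t p × v ∈ root τ) → Grown t τ
  grow t p nil rt _ _ = record
    { t⁺ = t ; embed = λ i → i ; embed≡ = λ _ → refl ; run = rt ; from = λ i → inj₁ (i , refl) ; onto = λ () }
  grow t p (node B l r) rt (node vl vr lr Bl Br) att = record
    { t⁺     = R.t⁺
    ; embed  = R.embed ∘ L.embed ∘ suc
    ; embed≡ = λ i → trans (R.embed≡ _) (L.embed≡ (suc i))
    ; run    = R.run
    ; from   = from
    ; onto   = λ where
        top → R.embed (L.embed zero) , trans (R.embed≡ _) (L.embed≡ zero)
        (left B∈) → let i , eq = L.onto B∈ in R.embed i , trans (R.embed≡ i) eq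
        (right B∈) → R.onto B∈
    }
    where
    t₁ = add t p B

    att₁ : ∀ {j v} → v ∈ bagAt t₁ j → v ∈ᵛ l ⊎ v ∈ᵛ r → v ∈ B
    att₁ {zero}  v∈ _ = v∈
    att₁ {suc j} v∈ (inj₁ v∈l) = proj₂ (att v∈ (left v∈l))
    att₁ {suc j} v∈ (inj₂ v∈r) = proj₂ (att v∈ (right v∈r))

    grownˡ : Grown t₁ l
    grownˡ = grow t₁ zero l (rt , λ v∈B v∈ → proj₁ (att v∈ (top v∈B))) vl
      (λ {j} v∈ v∈l → let v∈B = att₁ {j} v∈ (inj₁ v∈l) in v∈B , Bl v∈B v∈l)

    module L = Grown grownˡ

    att₂ : ∀ {j v} → v ∈ bagAt L.t⁺ j → v ∈ᵛ r → v ∈ B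
    att₂ {j} v∈ v∈r with L.from j
    ... | inj₁ (j′ , eq) = att₁ {j′} (subst (_ ∈_) eq v∈) (inj₂ v∈r)
    ... | inj₂ B∈        = lr (bag⊆ B∈ v∈) v∈r

    grownʳ : Grown L.t⁺ r
    grownʳ = grow L.t⁺ (L.embed zero) r L.run vr
      (λ {j} v∈ v∈r → let v∈B = att₂ {j} v∈ v∈r in subst (_ ∈_) (≡-sym (L.embed≡ zero)) v∈B , Br v∈B v∈r)

    module R = Grown grownʳ

    from : ∀ i → (∃ λ j → bagAt R.t⁺ i ≡ bagAt t j) ⊎ bagAt R.t⁺ i ∈ᵇ node B l r
    from i with R.from i
    ... | inj₂ B∈ = inj₂ (right B∈)
    ... | inj₁ (j , eq) with L.from j
    ...   | inj₂ B∈ = inj₂ (left (subst (_∈ᵇ l) (≡-sym eq) B∈))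
    ...   | inj₁ (zero , eq′)  = inj₂ (subst (_∈ᵇ node B l r) (≡-sym (trans eq eq′)) top)
    ...   | inj₁ (suc j′ , eq′) = inj₁ (j′ , trans eq eq′)

  fromTree : ∀ {k B l r} (G : Graph n) → let τ = node B l r in Valid τ → (∀ v → v ∈ᵛ τ) →
    (∀ {u v} → Adj G u v → ∃ λ B → B ∈ᵇ τ × u ∈ B × v ∈ B) →
    (∀ {B} → B ∈ᵇ τ → ∣ B ∣ ≤ suc k) → TreeDecomposition G k
  fromTree {k} {B} {l} {r} G vτ cov ed size = record
    { m       = _
    ; T       = leafyGraph t⁺
    ; isTree  = leafy-tree t⁺
    ; bag     = bagAt t⁺
    ; covers  = λ v → let b , b∈ , v∈ = ∈ᵛ⇒∈bag (cov v) ; i , eq = onto b∈ in i , subst (v ∈_) (≡-sym eq) v∈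
    ; edges   = λ u v e → let b , b∈ , u∈ , v∈ = ed e ; i , eq = onto b∈ in
        i , subst (u ∈_) (≡-sym eq) u∈ , subst (v ∈_) (≡-sym eq) v∈
    ; subtree = λ v → closed⇒connected t⁺ (running⇒closed t⁺ run v)
    ; width≤  = λ i → size ([ (λ (_ , eq) → subst (_∈ᵇ _) (≡-sym eq) top) , (λ b∈ → b∈) ]′ (from i))
    }
    -- The starting bag duplicates the root bag, which makes the attachment condition immediate.
    where open Grown (grow (single B) zero (node B l r) tt vτ (λ v∈ _ → v∈ , v∈))

-- Acyclic graphs as binary trees

module _ {m : ℕ} where

  open import Data.List.Membership.DecPropositional (Fin._≟_ {m}) using () renaming (_∈?_ to _∈ˡ?_)

  data Simple (E : Fin m → Fin m → Set) (y : Fin m) : Fin m → List (Fin m) → Set where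
    end  : Simple E y y (y ∷ [])
    cons : ∀ {u w xs} → E u w → u List.∉ xs → Simple E y w xs → Simple E y u (u ∷ xs)

  suffix : ∀ {E y w xs u} → Simple E y w xs → u List.∈ xs → ∃ (Simple E y u)
  suffix end           (here refl) = _ , end
  suffix p@(cons _ _ _) (here refl) = _ , p
  suffix (cons _ _ p)  (there u∈)  = suffix p u∈

  prepend : ∀ {E y u w xs} → E u w → Simple E y w xs → ∃ (Simple E y u)
  prepend {u = u} {xs = xs} e p with u ∈ˡ? xs
  ... | yes u∈ = suffix p u∈
  ... | no u∉  = _ , cons e u∉ p

  lookup-injective : ∀ {E y u xs} → Simple E y u xs → Injective _≡_ _≡_ (lookup xs)
  lookup-injective end {zero} {zero} _ = refl
  lookup-injective (cons _ _ _)  {zero}  {zero}  _  = refl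
  lookup-injective (cons _ u∉ _) {zero}  {suc j} eq = ⊥-elim (u∉ (subst (List._∈ _) (≡-sym eq) (∈-lookup j)))
  lookup-injective (cons _ u∉ _) {suc i} {zero}  eq = ⊥-elim (u∉ (subst (List._∈ _) eq (∈-lookup i)))
  lookup-injective (cons _ _ p)  {suc i} {suc j} eq = cong suc (lookup-injective p eq)

  lookup-adjacent : ∀ {E y u x xs} → Simple E y u (x ∷ xs) →
    ∀ (i : Fin (length xs)) → E (lookup (x ∷ xs) (inject₁ i)) (lookup (x ∷ xs) (suc i))
  lookup-adjacent (cons e _ end)          zero    = e
  lookup-adjacent (cons e _ (cons _ _ _)) zero    = e
  lookup-adjacent (cons _ _ end)            (suc ())
  lookup-adjacent (cons _ _ p@(cons _ _ _)) (suc i) = lookup-adjacent p i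

  lookup-last : ∀ {E y u x xs} → Simple E y u (x ∷ xs) → lookup (x ∷ xs) (fromℕ (length xs)) ≡ y
  lookup-last end                       = refl
  lookup-last (cons _ _ p@end)          = lookup-last p
  lookup-last (cons _ _ p@(cons _ _ _)) = lookup-last p

  module _ {T : Graph m} (acyclic : ¬ HasCycle T) where

    Other : Fin m → Fin m → Fin m → Fin m → Set
    Other x y u w = Adj T u w × ¬ (u ≡ x × w ≡ y)

    -- The direct step is excluded by `Other`, so a path has at least three vertices and closes to a
    -- cycle through the edge.
    no-detour : ∀ {x y xs} → Adj T x y → ¬ Simple (Other x y) y x xs
    no-detour e end = irrefl T e
    no-detour e (cons (_ , ne) _ end) = ne (refl , refl)
    no-detour e p@(cons _ _ (cons _ _ end)) = acyclic
      (_ , lookup _ , lookup-injective p , (λ i → proj₁ (lookup-adjacent p i)) , Graph.sym T e)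
    no-detour e p@(cons {xs = _ ∷ _ ∷ xs} _ _ (cons _ _ (cons _ _ _))) = acyclic
      (_ , lookup _ , lookup-injective p , (λ i → proj₁ (lookup-adjacent p i)) ,
       subst (λ z → Adj T z _) (≡-sym (lookup-last p)) (Graph.sym T e))

    avoiding : ∀ {x y u v P xs} → (∀ {a b} → P a → P b → ¬ (a ≡ x × b ≡ y)) →
      Walk T P u v → Simple (Other x y) y v xs → ∃ (Simple (Other x y) y u)
    avoiding ne (here _) p = _ , p
    avoiding ne (step pu e w) p =
      prepend (e , ne pu (walk-start w)) (proj₂ (avoiding ne w p))

    -- Otherwise the edge xy would close a cycle.
    gateway : ∀ {P Q : Fin m → Set} {x y z} → Adj T x y → ¬ P x → Walk T P z y →
      ¬ Q y → ¬ Walk T Q x z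
    gateway e ¬Px w ¬Qy w′ =
      no-detour e (proj₂ (avoiding (λ _ qb (_ , eq) → ¬Qy (subst _ eq qb)) w′
        (proj₂ (avoiding (λ pa _ (eq , _) → ¬Px (subst _ eq pa)) w end))))

module _ {n : ℕ} {G : Graph n} {k : ℕ} (D : TreeDecomposition G k) where

  open TreeDecomposition D
  open IsTree isTree
  open import Data.List.Membership.DecPropositional (Fin._≟_ {m}) using () renaming (_∈?_ to _∈ˡ?_)

  -- State of a search of the decomposition tree. `linked` supplies the walk among seen indices that
  -- `gateway` plays against a new one.
  record Explored : Set where
    field
      τ      : Tree n
      valid  : Valid τ
      seen   : List (Fin m)
      root∈  : nonempty List.∈ seen
      placed : ∀ {i} → i List.∈ seen → bag i ∈ᵇ τ
      origin : ∀ {B} → B ∈ᵇ τ → ∃ λ i → i List.∈ seen × B ≡ bag i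
      linked : InducedConnected T (List._∈ seen)

  open Explored

  start : Explored
  start = record
    { τ      = node (bag nonempty) nil nil
    ; valid  = node nil nil (λ ()) (λ _ ()) (λ _ ())
    ; seen   = nonempty ∷ []
    ; root∈  = here refl
    ; placed = λ where (here refl) → top
    ; origin = λ where top → nonempty , here refl , refl
                       (left ())
                       (right ())
    ; linked = λ where _ _ (here refl) (here refl) → here (here refl)
    }

  extend : (S : Explored) → ∀ {i p} → p List.∈ seen S → i List.∉ seen S → Adj T i p →
    ∃ λ S′ → seen S′ ≡ i ∷ seen S
  extend S {i} {p} p∈ i∉ e = record
    { τ      = insert p∈τ (bag i)
    ; valid  = insert-valid p∈τ (valid S) new
    ; seen   = i ∷ seen S
    ; root∈  = there (root∈ S)
    ; placed = λ where (here refl) → insert-new p∈τ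
                       (there j∈)  → insert-old p∈τ (placed S j∈)
    ; origin = λ b∈ → [ (λ eq → i , here refl , eq)
                      , (λ b∈τ → let j , j∈ , eq = origin S b∈τ in j , there j∈ , eq) ]′ (insert-bag⁻ p∈τ b∈)
    ; linked = linked′
    } , refl
    where
    p∈τ : bag p ∈ᵇ τ S
    p∈τ = placed S p∈

    new : ∀ {v} → v ∈ bag i → v ∈ᵛ τ S → v ∈ bag p
    new {v} v∈i v∈τ =
      let b , b∈ , v∈b = ∈ᵛ⇒∈bag v∈τ
          j , j∈ , eq = origin S b∈
      -- If `bag p` lacked `v`, the walk from `i` to `j` through bags containing `v` would avoid
      -- `p`, and the walk from `j` to `p` through seen indices avoids `i`.
      in decidable-stable (v ∈? bag p) λ v∉p →
           gateway acyclic e i∉ (linked S j p j∈ p∈) v∉p (subtree v i j v∈i (subst (v ∈_) eq v∈b))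

    weaken : ∀ {u v} → Walk T (List._∈ seen S) u v → Walk T (List._∈ (i ∷ seen S)) u v
    weaken (here u∈)     = here (there u∈)
    weaken (step u∈ a w) = step (there u∈) a (weaken w)

    to-new : ∀ {u} → u List.∈ seen S → Walk T (List._∈ (i ∷ seen S)) i u
    to-new u∈ = step (here refl) e (weaken (linked S _ _ p∈ u∈))

    linked′ : InducedConnected T (List._∈ (i ∷ seen S))
    linked′ _ _ (here refl) (here refl) = here (here refl)
    linked′ _ _ (here refl) (there v∈)  = to-new v∈
    linked′ _ _ (there u∈)  (here refl) = reverseʷ (to-new u∈)
    linked′ _ _ (there u∈)  (there v∈)  = weaken (linked S _ _ u∈ v∈)

  follow : (S : Explored) → ∀ {u j} → Walk T (λ _ → ⊤) u j → u List.∈ seen S →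
    ∃ λ S′ → j List.∈ seen S′ × (∀ {i} → i List.∈ seen S → i List.∈ seen S′)
  follow S (here _) u∈ = S , u∈ , λ i∈ → i∈
  follow S (step {w = w} _ e walk) u∈ with w ∈ˡ? seen S
  ... | yes w∈ = follow S walk w∈
  ... | no w∉ with extend S u∈ w∉ (Graph.sym T e)
  ...   | S₁ , eq =
    let S₂ , j∈ , ⊆₂ = follow S₁ walk (subst (w List.∈_) (≡-sym eq) (here refl))
    in S₂ , j∈ , λ i∈ → ⊆₂ (subst (_ List.∈_) (≡-sym eq) (there i∈))

  explore : ∀ js → ∃ λ S → ∀ {j} → j List.∈ js → j List.∈ seen S
  explore [] = start , λ ()
  explore (j ∷ js) =
    let S , ⊆₁ = explore js
        S′ , j∈ , ⊆₂ = follow S (connected nonempty j tt tt) (root∈ S)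
    in S′ , λ where (here refl) → j∈
                    (there i∈)  → ⊆₂ (⊆₁ i∈)

  toTree : ∃ λ τ → Valid τ × (∀ i → bag i ∈ᵇ τ) × (∀ {B} → B ∈ᵇ τ → ∃ λ i → B ≡ bag i)
  toTree = let S , all = explore (allFin m) in
    τ S , valid S , (λ i → placed S (all (∈-allFin i))) , λ b∈ → let i , _ , eq = origin S b∈ in i , eq

  -- The initial marked edge dangles from the root with `nil` behind it; rerooting reaches the
  -- others.
  toSplit : ∃ λ τ → Split G nil τ × ∃ (_∈ᵇ τ) × (∀ {B} → B ∈ᵇ τ → ∣ B ∣ ≤ suc k)
  toSplit =
    let τ , vτ , all , from = toTree in
    τ ,
    record
      { validˡ = nil
      ; validʳ = vτ
      ; common = λ ()
      ; spans  = λ x → let i , x∈ = covers x in inj₂ (bag⊆ (all i) x∈)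
      ; edges  = λ {u} {v} e → let i , u∈ , v∈ = edges u v e in bag i , inj₂ (all i) , u∈ , v∈
      } ,
    (bag nonempty , all nonempty) ,
    λ b∈ → let i , eq = from b∈ in subst (λ b → ∣ b ∣ ≤ suc k) (≡-sym eq) (width≤ i)

-- Hanging the remaining elements as leaves

module _ {h w : ℕ} {T : Tree h} (vT : Valid T) (T≤ : ∀ {B} → B ∈ᵇ T → ∣ B ∣ ≤ w)
         {Cov : Fin h → Subset h → Set} (homes : ∀ P → ∃ λ X → X ∈ᵇ T × Cov P X) where

  record Hung (ps : List (Fin h)) : Set where
    field
      T⁺       : Tree h
      valid    : Valid T⁺
      old      : ∀ {B} → B ∈ᵇ T → B ∈ᵇ T⁺
      bag≤     : ∀ {B} → B ∈ᵇ T⁺ → ∣ B ∣ ≤ suc w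
      attached : ∀ {P} → P List.∈ ps → P ∈ᵛ T ⊎ ∃ λ X → X ∈ᵇ T × (X ∪ ⁅ P ⁆) ∈ᵇ T⁺ × Cov P X
      origin   : ∀ {P} → P ∈ᵛ T⁺ → P ∈ᵛ T ⊎ P List.∈ ps

  -- Homes are bags of the original `T`, which insertions preserve. As `P` is new, its bag meets the
  -- tree only within `X`.
  hang : ∀ ps → Hung ps
  hang [] = record
    { T⁺ = T ; valid = vT ; old = λ b∈ → b∈ ; bag≤ = ℕ.m≤n⇒m≤1+n ∘ T≤ ; attached = λ () ; origin = inj₁ }
  hang (P ∷ ps) with hang ps
  ... | H with P ∈ᵛ? Hung.T⁺ H
  ...   | yes P∈ = record
    { T⁺ = T⁺ ; valid = valid ; old = old ; bag≤ = bag≤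
    ; attached = λ where (here refl) → [ inj₁ , attached ]′ (origin P∈)
                         (there Q∈)  → attached Q∈
    ; origin = Sum.map₂ there ∘ origin
    }
    where open Hung H
  ...   | no P∉ = record
    { T⁺       = insert X∈⁺ (X ∪ ⁅ P ⁆)
    ; valid    = insert-valid X∈⁺ valid λ Q∈ Q∈T⁺ →
        [ (λ Q∈X → Q∈X) , (λ Q∈P → ⊥-elim (P∉ (subst (_∈ᵛ T⁺) (x∈⁅y⁆⇒x≡y P Q∈P) Q∈T⁺))) ]′ (∪⁻ {p = X} Q∈)
    ; old      = insert-old X∈⁺ ∘ old
    ; bag≤     = λ b∈ → [ (λ where refl → new≤) , bag≤ ]′ (insert-bag⁻ X∈⁺ b∈)
    ; attached = λ where
        (here refl) → inj₂ (X , X∈ , insert-new X∈⁺ , cov)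
        (there Q∈)  → Sum.map₂ (λ (Y , Y∈ , new∈ , c) → Y , Y∈ , insert-old X∈⁺ new∈ , c) (attached Q∈)
    ; origin   = λ Q∈ → [ (λ Q∈new → [ (λ Q∈X → inj₁ (bag⊆ X∈ Q∈X))
                                     , (λ Q∈P → inj₂ (here (x∈⁅y⁆⇒x≡y P Q∈P))) ]′ (∪⁻ {p = X} Q∈new))
                        , Sum.map₂ there ∘ origin ]′ (∈ᵛ-insert⁻ X∈⁺ Q∈)
    }
    where
    open Hung H

    X : Subset h
    X = proj₁ (homes P)

    X∈ : X ∈ᵇ T
    X∈ = proj₁ (proj₂ (homes P))

    cov : Cov P X
    cov = proj₂ (proj₂ (homes P))

    X∈⁺ : X ∈ᵇ T⁺
    X∈⁺ = old X∈

    new≤ : ∣ X ∪ ⁅ P ⁆ ∣ ≤ suc w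
    new≤ = ℕ.≤-trans (∣p∪q∣≤∣p∣+∣q∣ X ⁅ P ⁆) (ℕ.≤-trans
      (ℕ.+-mono-≤ (T≤ X∈) (ℕ.≤-reflexive (∣⁅x⁆∣≡1 P))) (ℕ.≤-reflexive (ℕ.+-comm w 1)))

-- The clique graph of the bags and the width bound

bagGraph : ∀ {h} → Tree h → Graph h
bagGraph T = record
  { Adj    = λ P Q → P ≢ Q × ∃ λ B → B ∈ᵇ T × P ∈ B × Q ∈ B
  ; sym    = λ (P≢Q , B , B∈ , P∈ , Q∈) → P≢Q ∘ ≡-sym , B , B∈ , Q∈ , P∈
  ; irrefl = λ (P≢P , _) → P≢P refl
  }

bagGraph-tw : ∀ {h k B} (T : Tree h) → B ∈ᵇ T → Valid T → (∀ P → P ∈ᵛ T) → (∀ {B} → B ∈ᵇ T → ∣ B ∣ ≤ suc k) →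
  TwLe (bagGraph T) k
bagGraph-tw T@(node _ _ _) _ vT cov T≤ = fromTree (bagGraph T) vT cov proj₂ T≤

width-bound : ∀ t → let s = suc t ; p = s + (2 ^ s + (2 ^ s + 2 ^ s)) in
  2 ^ p + 2 ^ p ≤ 2 ^ (2 ^ (t + 4) + 4 * (t + 1))
width-bound t = begin
  2 ^ p + 2 ^ p                        ≡⟨ cong (2 ^ p +_) (ℕ.+-identityʳ (2 ^ p)) ⟨
  2 ^ suc p                            ≤⟨ ℕ.^-monoʳ-≤ 2 exponent ⟩
  2 ^ (2 ^ (t + 4) + 4 * (t + 1))      ∎
  where
  open ℕ.≤-Reasoning
  s = suc t
  p = s + (2 ^ s + (2 ^ s + 2 ^ s))
  x = 2 ^ t

  exponent : suc p ≤ 2 ^ (t + 4) + 4 * (t + 1)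
  exponent = begin
    -- Since `p` is `6 * x + (t + 1)` and `x` is at least one, the left side is at most
    -- `7 * x + (t + 1)`; the slack added next completes `16 * x`.
    1 + p                                           ≤⟨ ℕ.+-monoˡ-≤ p (ℕ.m^n>0 2 t) ⟩
    x + p                                           ≤⟨ ℕ.m≤m+n (x + p) (9 * x + 3 * (t + 1)) ⟩
    (x + p) + (9 * x + 3 * (t + 1))                 ≡⟨ regroup ⟩
    x * 16 + 4 * (t + 1)                            ≡⟨ cong (_+ 4 * (t + 1)) (ℕ.^-distribˡ-+-* 2 t 4) ⟨
    2 ^ (t + 4) + 4 * (t + 1)                       ∎
    where
    open +-*-Solver

    regroup : (x + p) + (9 * x + 3 * (t + 1)) ≡ x * 16 + 4 * (t + 1)
    regroup = solve 2 (λ x t →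
      (x :+ ((con 1 :+ t) :+ (con 2 :* x :+ (con 2 :* x :+ con 2 :* x)))) :+ (con 9 :* x :+ con 3 :* (t :+ con 1))
        := x :* con 16 :+ con 4 :* (t :+ con 1)) refl x t

-- The intersection support

module Support {n h k : ℕ} {G : Graph n} (Hs : Fin h → Subset n) (Ks : Fin k → Subset n)
  (npH : NonPiercing G Hs) (npK : NonPiercing G Ks)
  {τ₀ : Tree n} (split : Split G nil τ₀) {B₀ : Subset n} (B₀∈ : B₀ ∈ᵇ τ₀)
  {s : ℕ} (τ₀≤ : ∀ {B} → B ∈ᵇ τ₀ → ∣ B ∣ ≤ s) where

  covered? : ∀ v → Dec (∃ λ P → v ∈ Hs P)
  covered? v = Fin.any? λ P → v ∈? Hs P

  C : Subset n
  C = setOf covered?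

  open Primal C Ks
  open Dual Hs
  open PrimSplit (split-reroot {G = G})

  H⊆C : ∀ {P v} → v ∈ Hs P → v ∈ C
  H⊆C {P} v∈ = ∈-setOf⁺ covered? (P , v∈)

  sepH : ∀ {σ τ} → PrimI σ τ → ∀ P P′ → Sep (λ v → v ∈ Hs P × v ∉ Hs P′) σ τ
  sepH i P P′ = prim-sep (H⊆C ∘ proj₁)
    (λ s xu xv u∈ v∈ → let w , xw , w∈ = connected⇒sep s (npH P P′) xu xv u∈ v∈ in w , xw , inj₁ w∈) i

  -- The covered part of `K` need not be connected in `G`; the representatives make up for this.
  sepK : ∀ j {σ τ} → PrimI σ τ → Sep (λ v → v ∈ Ks j × v ∈ C) σ τ
  sepK j = prim-sep proj₂ (crossing split-reroot (λ s a b → connected⇒sep s (npK a b)))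

  total : ∀ {σ τ} → PrimI σ τ → ∀ {P v} → v ∈ Hs P → v ∈ᵛ σ ⊎ v ∈ᵛ τ
  total (_ , _ , s , refl , refl) {v = v} v∈ =
    Sum.map (prim-covers (H⊆C v∈)) (prim-covers (H⊆C v∈)) (Split.spans s v)

  τ₁ : Tree n
  τ₁ = prim nil τ₀

  i₁ : PrimI nil τ₁
  i₁ = nil , τ₀ , split , refl , refl

  T₁ : Tree h
  T₁ = link ⊥ τ₁

  w : ℕ
  w = 2 ^ (s + (2 ^ s + (2 ^ s + 2 ^ s))) + 2 ^ (s + (2 ^ s + (2 ^ s + 2 ^ s)))

  T₁≤ : ∀ {B} → B ∈ᵇ T₁ → ∣ B ∣ ≤ w
  T₁≤ = ∣link∣≤ {m = ⊥} (∣⊥∣≤ h) (∣prim∣≤ {σ = nil} τ₀ (∣⊥∣≤ n) τ₀≤)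

  Covers : Fin h → Subset h → Set
  Covers P X = ∀ {v} → v ∈ Hs P → ∃ λ P′ → P′ ∈ X × v ∈ Hs P′

  homes : ∀ P → ∃ λ X → X ∈ᵇ T₁ × Covers P X
  homes P = go τ₀ B₀∈ i₁
    where
    go : ∀ {B} τ → B ∈ᵇ τ → PrimI nil (prim nil τ) → ∃ λ X → X ∈ᵇ link ⊥ (prim nil τ) × Covers P X
    go (node _ _ _) _ i = home prim-reroot sepH total P i (λ _ ())

  open Hung (hang (link-valid prim-reroot sepH total τ₁ i₁) T₁≤ homes (allFin h))

  Q : Graph h
  Q = bagGraph T⁺

  T₁⇒core : ∀ {P} → P ∈ᵛ T₁ → P ∈ᵛ core τ₁
  T₁⇒core P∈ = [ ⊥-elim ∘ ∉⊥ , (λ P∈′ → P∈′) ]′ (link⊆ P∈)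

  T₁-bag : ∃ (_∈ᵇ T₁)
  T₁-bag = go τ₀ B₀∈
    where
    go : ∀ {B} τ → B ∈ᵇ τ → ∃ (_∈ᵇ link ⊥ (prim nil τ))
    go (node _ _ _) _ = _ , top

  Q-tw : ∀ {k} → w ≤ k → TwLe Q k
  Q-tw w≤k = bagGraph-tw T⁺ (old (proj₂ T₁-bag)) valid
    (λ P → [ (λ P∈ → let _ , b∈ , P∈b = ∈ᵛ⇒∈bag P∈ in bag⊆ (old b∈) P∈b)
           , (λ (X , _ , new∈ , _) → bag⊆ new∈ (∪ʳ {p = X} (x∈⁅x⁆ P))) ]′ (attached (∈-allFin P)))
    -- The one element added by `hang` is absorbed by the one in the definition of width.
    (λ b∈ → ℕ.≤-trans (bag≤ b∈) (s≤s w≤k))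

  Q-support : IsIntersectionSupport Hs Ks Q
  Q-support j P P′ (v , v∈ , v∈K) (v′ , v′∈ , v′∈K) =
    let P₁ , P₁∈ , h₁ , w₁ = to-core P (v , v∈ , v∈K , H⊆C v∈)
        P₂ , P₂∈ , h₂ , w₂ = to-core P′ (v′ , v′∈ , v′∈K , H⊆C v′∈)
    in forget (w₁ ++ʷ core-walk′ P₁∈ h₁ P₂∈ h₂ ++ʷ reverseʷ w₂)
    where
    Hit : Fin h → Set
    Hit P = ∃ λ v → v ∈ Hs P × v ∈ Ks j × v ∈ C

    core-walk′ : ∀ {P P′} → P ∈ᵛ core τ₁ → Hit P → P′ ∈ᵛ core τ₁ → Hit P′ → Walk Q Hit P P′
    core-walk′ = core-walk prim-reroot sepH total (λ (_ , v∈C) → ∈-setOf⁻ covered? v∈C) (sepK j) Q τ₁ i₁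
      (λ B∈ P∈ P′∈ P≢P′ → P≢P′ , _ , old B∈ , P∈ , P′∈)

    -- A hung `P` shares its vertex of `K` with a member `P₁` of its home `X`, and the two are
    -- adjacent through the bag `X ∪ ⁅ P ⁆`.
    to-core : ∀ P → Hit P → ∃ λ P₁ → P₁ ∈ᵛ core τ₁ × Hit P₁ × Walk Q Hit P P₁
    to-core P hP@(v , v∈ , v∈K , v∈C) with attached (∈-allFin P)
    ... | inj₁ P∈ = P , T₁⇒core P∈ , hP , here hP
    ... | inj₂ (X , X∈ , new∈ , cov) with cov v∈
    ...   | P₁ , P₁∈ , v∈₁ with P Fin.≟ P₁
    ...     | yes refl = P , T₁⇒core (bag⊆ X∈ P₁∈) , hP , here hP
    ...     | no P≢P₁ = P₁ , T₁⇒core (bag⊆ X∈ P₁∈) , h₁ ,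
      step hP (P≢P₁ , X ∪ ⁅ P ⁆ , new∈ , ∪ʳ {p = X} (x∈⁅x⁆ P) , ∪ˡ P₁∈) (here h₁)
      where
      h₁ : Hit P₁
      h₁ = v , v∈₁ , v∈K , v∈C

    forget : ∀ {P P′} → Walk Q Hit P P′ → Walk Q (λ i → Meets (Hs i) (Ks j)) P P′
    forget (here (v , v∈ , v∈K , _))     = here (v , v∈ , v∈K)
    forget (step (v , v∈ , v∈K , _) e w) = step (v , v∈ , v∈K) e (forget w)

theorem3 : {n : ℕ} (G : Graph n) (t : ℕ) → TwEq G t →
    {h k : ℕ} (Hs : Fin h → Subset n) (Ks : Fin k → Subset n) →
    ConnectedFamily G h Hs → NonPiercing G Hs →
    ConnectedFamily G k Ks → NonPiercing G Ks →
    Σ (Graph h) λ Q → IsIntersectionSupport Hs Ks Q × TwLe Q (2 ^ (2 ^ (t + 4) + 4 * (t + 1)))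
theorem3 G t (D , _) Hs Ks _ npH _ npK with toSplit D
... | τ , split , (_ , B∈) , τ≤ = Q , Q-support , Q-tw (width-bound t)
  where open Support Hs Ks npH npK split B∈ τ≤
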